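{- For all $S \in \mathbf{C}$, $$\dim(S) = \liminf_{n\to\infty} \dim(S[0..n-1]),$$ where the left-hand side is the dimension of the infinite sequence $S$ and the right-hand side involves the dimensions of its finite prefixes.
   Context: Strings are elements of $\{0,1\}^*$; $\lambda$ is the empty string; $\mathbf{C}$ (Cantor space) is the set of all infinite binary sequences $S = S[0]S[1]S[2]\ldots$; $S[0..n-1]$ is the string of the first $n$ bits of $S$. A function $f : D \to \mathbb{R}$ on a discrete domain $D$ is lower semicomputable if there is a computable $\hat f : D \times \mathbb{N} \to \mathbb{Q}$ with $\hat f(x,t) \le \hat f(x,t+1) < f(x)$ for all $x,t$ and $\lim_{t\to\infty} \hat f(x,t) = f(x)$ for all $x$. Constructive means lower semicomputable. Dimension of sequences. For $s \in [0,\infty)$, an $s$-supergale is a function $d : \{0,1\}^* \to [0,\infty)$ such that $d(w) \ge 2^{ -s}[d(w0)+d(w1)]$ for all $w$. It succeeds on $S$ if $\limsup_{n\to\infty} d(S[0..n-1]) = \infty$. The dimension $\dim(S)$ of $S \in \mathbf{C}$ is the infimum of all $s \in [0,\infty)$ for which some constructive $s$-supergale succeeds on $S$. Dimension of strings. Let $\square$ be a termination symbol and $\mathcal{T} = \{0,1\}^* \cup \{0,1\}^*\square$; lengths count the symbol $\square$, so $|w\square| = |w|+1$. For $s \in [0,\infty)$, an $s$-termgale is a function $d : \mathcal{T} \to [0,\infty)$ with $d(\lambda) \le 1$ and $d(w) \ge 2^{ -s}[d(w0)+d(w1)+d(w\square)]$ for all $w \in \{0,1\}^*$. A termgale is a family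 $d = \{d^{(s)} \mid s \in [0,\infty)\}$ where each $d^{(s)}$ is an $s$-termgale and $2^{ -s|x|}d^{(s)}(x) = 2^{ -s'|x|}d^{(s')}(x)$ for all $s,s' \in [0,\infty)$, $x \in \mathcal{T}$. It is constructive if $d^{(0)}$ is constructive. A constructive termgale $\tilde d$ is optimal if for every constructive termgale $d$ there is a constant $\alpha > 0$ such that $\tilde d^{(s)}(w\square) \ge \alpha d^{(s)}(w\square)$ for all $s \in [0,\infty)$ and $w \in \{0,1\}^*$. Optimal constructive termgales exist; fix one, $\mathbf{d}_\square$. The dimension of a string $w \in \{0,1\}^*$ is $\dim(w) = \inf\{s \in [0,\infty) \mid \mathbf{d}_\square^{(s)}(w\square) > 1\}$. -}

module Defs where

open import Data.Bool.Base using (Bool; true; false)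
open import Data.Fin.Base using (Fin)
open import Data.Integer.Base as ℤ using (ℤ; +_; -1ℤ)
import Data.Integer.Properties as ℤₚ
open import Data.List.Base using (List; []; _∷_; _∷ʳ_; length; applyUpTo)
open import Data.Nat.Base as ℕ using (ℕ; zero; suc)
import Data.Nat.Properties as ℕₚ
open import Data.Product.Base using (Σ; Σ-syntax; ∃; ∃₂; ∃-syntax; _×_; _,_; proj₁; proj₂)
open import Data.Rational.Base
open import Data.Rational.Properties
import Data.Rational.Unnormalised.Base as ℚᵘ
import Data.Rational.Unnormalised.Properties as ℚᵘₚ
open import Data.Rational.Solver using (module +-*-Solver)
open import Data.Sum.Base using (_⊎_; inj₁; inj₂)
open import Data.Vec.Base using (Vec; []; _∷_; lookup)
open import Algebra.Bundles using (CommutativeRing; CommutativeSemiring)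
open import Function.Bundles using (_⇔_)
open import Level using (Lift; 0ℓ) renaming (suc to lsuc)
open import Relation.Binary.Definitions using (tri<; tri≈; tri>)
open import Relation.Binary.PropositionalEquality
open import Relation.Nullary using (¬_; yes; no; contradiction)

private
  ℚ-commutativeSemiring = CommutativeRing.commutativeSemiring +-*-commutativeRing
  ℚ-semiring = CommutativeSemiring.semiring ℚ-commutativeSemiring

open import Algebra.Properties.Semiring.Exp ℚ-semiring public
  using (_^_; ^-homo-*; ^-assocʳ)
open import Algebra.Properties.CommutativeSemiring.Exp ℚ-commutativeSemiring public
  using (^-distrib-*)

------------------------------------------------------------------------
-- Rational arithmetic

2ℚ 3ℚ 4ℚ : ℚ
2ℚ = 1ℚ + 1ℚ
3ℚ = 2ℚ + 1ℚ
4ℚ = 2ℚ + 2ℚ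

0≤1 : 0ℚ ≤ 1ℚ
0≤1 = nonNegative⁻¹ 1ℚ

0<1 : 0ℚ < 1ℚ
0<1 = positive⁻¹ 1ℚ

1≤2 : 1ℚ ≤ 2ℚ
1≤2 = ≤ᵇ⇒≤ _

1<2 : 1ℚ < 2ℚ
1<2 = +-monoʳ-< 1ℚ 0<1

private
  frac-≃ : ∀ a b → toℚᵘ (+ a / suc b) ℚᵘ.≃ ℚᵘ.mkℚᵘ (+ a) b
  frac-≃ a b = toℚᵘ-fromℚᵘ (ℚᵘ.mkℚᵘ (+ a) b)

  ℤ-mul : ∀ a b → + a ℤ.* + b ≡ + (a ℕ.* b)
  ℤ-mul a b = sym (ℤₚ.pos-* a b)

frac-< : ∀ {a b c d} → a ℕ.* suc d ℕ.< c ℕ.* suc b → + a / suc b < + c / suc d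
frac-< {a} {b} {c} {d} h = toℚᵘ-cancel-<
  (ℚᵘₚ.<-respʳ-≃ (ℚᵘₚ.≃-sym (frac-≃ c d))
    (ℚᵘₚ.<-respˡ-≃ (ℚᵘₚ.≃-sym (frac-≃ a b))
      (ℚᵘ.*<* (subst₂ ℤ._<_ (sym (ℤ-mul a (suc d))) (sym (ℤ-mul c (suc b))) (ℤ.+<+ h)))))

frac-<⁻¹ : ∀ {a b c d} → + a / suc b < + c / suc d → a ℕ.* suc d ℕ.< c ℕ.* suc b
frac-<⁻¹ {a} {b} {c} {d} h =
  ℤₚ.drop‿+<+ (subst₂ ℤ._<_ (ℤ-mul a (suc d)) (ℤ-mul c (suc b))
    (ℚᵘₚ.drop-*<* (ℚᵘₚ.<-respʳ-≃ (frac-≃ c d) (ℚᵘₚ.<-respˡ-≃ (frac-≃ a b) (toℚᵘ-mono-< h)))))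

frac-+ : ∀ a c b → + a / suc b + + c / suc b ≡ + (a ℕ.+ c) / suc b
frac-+ a c b = toℚᵘ-injective
  (ℚᵘₚ.≃-trans (toℚᵘ-homo-+ (+ a / suc b) (+ c / suc b))
    (ℚᵘₚ.≃-trans (ℚᵘₚ.+-cong (frac-≃ a b) (frac-≃ c b))
      (ℚᵘₚ.≃-trans (ℚᵘ.*≡* eq) (ℚᵘₚ.≃-sym (frac-≃ (a ℕ.+ c) b)))))
  where
  B = + suc b
  eq : (+ a ℤ.* B ℤ.+ + c ℤ.* B) ℤ.* B ≡ (+ (a ℕ.+ c)) ℤ.* (+ (suc b ℕ.* suc b))
  eq = begin
    (+ a ℤ.* B ℤ.+ + c ℤ.* B) ℤ.* B ≡⟨ cong (ℤ._* B) (sym (ℤₚ.*-distribʳ-+ B (+ a) (+ c))) ⟩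
    ((+ a ℤ.+ + c) ℤ.* B) ℤ.* B     ≡⟨ ℤₚ.*-assoc (+ a ℤ.+ + c) B B ⟩
    (+ (a ℕ.+ c)) ℤ.* (B ℤ.* B)     ≡⟨ cong ((+ (a ℕ.+ c)) ℤ.*_) (ℤ-mul (suc b) (suc b)) ⟩
    (+ (a ℕ.+ c)) ℤ.* (+ (suc b ℕ.* suc b)) ∎
    where open ≡-Reasoning

archimedean′ : ∀ u b → ∃[ k ] u < + suc k / suc b
archimedean′ u@(mkℚ (+ n) d _) b = n ℕ.* suc b , toℚᵘ-cancel-<
  (ℚᵘₚ.<-respʳ-≃ (ℚᵘₚ.≃-sym (frac-≃ (suc (n ℕ.* suc b)) b))
    (ℚᵘ.*<* (subst₂ ℤ._<_ (sym (ℤ-mul n (suc b))) (sym (ℤ-mul (suc (n ℕ.* suc b)) (suc d)))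
      (ℤ.+<+ (ℕₚ.m≤m*n (suc (n ℕ.* suc b)) (suc d))))))
archimedean′ u@(mkℚ (ℤ.-[1+ n ]) d _) b = 0 , <-trans (negative⁻¹ u) (frac-< {0} {0} {1} {b} (ℕ.s≤s ℕ.z≤n))

-- Witnesses are kept abstract since unfolding them makes type checking blow up.
abstract
  archimedean : ∀ u b → ∃[ k ] u < + suc k / suc b
  archimedean = archimedean′

*-1/-cancel : ∀ p D .{{_ : NonZero D}} → p * 1/ D * D ≡ p
*-1/-cancel p D = trans (*-assoc p (1/ D) D) (trans (cong (p *_) (*-inverseˡ D)) (*-identityʳ p))

small-frac′ : ∀ ε → 0ℚ < ε → ∃[ b ] + 2 / suc b < ε
small-frac′ ε 0<ε = k , (begin-strict
  + 2 / suc k                         ≡⟨ lem ⟩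
    2ℚ * r                              ≡⟨ cong (_* r) (sym e₁) ⟩
    2ℚ * 1/ε * ε * r                    <⟨ *-monoˡ-<-pos r {{positive 0<r}} (*-monoˡ-<-pos ε {{positive 0<ε}} h) ⟩
    N * ε * r                           ≡⟨ solve 3 (λ n e r → n :* e :* r := e :* (n :* r)) refl N ε r ⟩
    ε * (N * r)                         ≡⟨ cong (ε *_) e₂ ⟩
    ε * 1ℚ                              ≡⟨ *-identityʳ ε ⟩
    ε                                   ∎)
  where
  open ≤-Reasoning
  open +-*-Solver
  instance _ = pos⇒nonZero ε {{positive 0<ε}}
  1/ε = 1/ ε
  kh = archimedean (2ℚ * 1/ε) 0
  k = proj₁ kh
  h = proj₂ kh
  N = + suc k / 1
  r = + 1 / suc k
  0<r : 0ℚ < r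
  0<r = frac-< {0} {0} {1} {k} (ℕ.s≤s ℕ.z≤n)
  lem : + 2 / suc k ≡ 2ℚ * r
  lem = trans (sym (frac-+ 1 1 k)) (solve 1 (λ r → r :+ r := con 2ℚ :* r) refl r)
  e₁ : 2ℚ * 1/ε * ε ≡ 2ℚ
  e₁ = *-1/-cancel 2ℚ ε
  e₂ : N * r ≡ 1ℚ
  e₂ = toℚᵘ-injective (ℚᵘₚ.≃-trans (toℚᵘ-homo-* N r)
    (ℚᵘₚ.≃-trans (ℚᵘₚ.*-cong (frac-≃ (suc k) 0) (frac-≃ 1 k))
      (ℚᵘ.*≡* (trans (ℤₚ.*-identityʳ _) (trans (ℤₚ.*-identityʳ _)
        (trans (cong (λ m → + suc m) (sym (ℕₚ.+-identityʳ k))) (sym (ℤₚ.*-identityˡ _))))))))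

abstract
  small-frac : ∀ ε → 0ℚ < ε → ∃[ b ] + 2 / suc b < ε
  small-frac = small-frac′

*-mono-≤⁺ : ∀ {a b c d} → 0ℚ ≤ c → 0ℚ ≤ b → a ≤ b → c ≤ d → a * c ≤ b * d
*-mono-≤⁺ {a} {b} {c} {d} 0≤c 0≤b a≤b c≤d = ≤-trans
  (*-monoʳ-≤-nonNeg c {{nonNegative 0≤c}} a≤b)
  (*-monoˡ-≤-nonNeg b {{nonNegative 0≤b}} c≤d)

*-nonneg : ∀ {a b} → 0ℚ ≤ a → 0ℚ ≤ b → 0ℚ ≤ a * b
*-nonneg {a} {b} 0≤a 0≤b = subst (_≤ a * b) (*-zeroˡ b) (*-monoʳ-≤-nonNeg b {{nonNegative 0≤b}} 0≤a)

*-pos : ∀ {a b} → 0ℚ < a → 0ℚ < b → 0ℚ < a * b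
*-pos {a} {b} 0<a 0<b = subst (_< a * b) (*-zeroˡ b) (*-monoˡ-<-pos b {{positive 0<b}} 0<a)

^-nonneg : ∀ {q} n → 0ℚ ≤ q → 0ℚ ≤ q ^ n
^-nonneg zero    _   = 0≤1
^-nonneg (suc n) 0≤q = *-nonneg 0≤q (^-nonneg n 0≤q)

^-pos : ∀ {q} n → 0ℚ < q → 0ℚ < q ^ n
^-pos zero    _   = 0<1
^-pos (suc n) 0<q = *-pos 0<q (^-pos n 0<q)

^-mono : ∀ {q r} n → 0ℚ ≤ q → q ≤ r → q ^ n ≤ r ^ n
^-mono zero    _   _   = ≤-refl
^-mono (suc n) 0≤q q≤r = *-mono-≤⁺ (^-nonneg n 0≤q) (≤-trans 0≤q q≤r) q≤r (^-mono n 0≤q q≤r)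

1^ : ∀ n → 1ℚ ^ n ≡ 1ℚ
1^ zero    = refl
1^ (suc n) = trans (*-identityˡ (1ℚ ^ n)) (1^ n)

2^-pos : ∀ n → 0ℚ < 2ℚ ^ n
2^-pos n = ^-pos n (<-≤-trans 0<1 1≤2)

1≤2^ : ∀ n → 1ℚ ≤ 2ℚ ^ n
1≤2^ n = subst (_≤ 2ℚ ^ n) (1^ n) (^-mono n 0≤1 1≤2)

2^-mono-< : ∀ {m n} → m ℕ.< n → 2ℚ ^ m < 2ℚ ^ n
2^-mono-< {m} {n} m<n = begin-strict
  2ℚ ^ m                          ≡⟨ sym (*-identityˡ _) ⟩
  1ℚ * 2ℚ ^ m                     <⟨ *-monoˡ-<-pos (2ℚ ^ m) {{positive (2^-pos m)}} 1<2 ⟩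
  2ℚ * 2ℚ ^ m                     ≡⟨ sym (*-identityʳ _) ⟩
  2ℚ ^ suc m * 1ℚ                 ≤⟨ *-monoˡ-≤-nonNeg (2ℚ ^ suc m) {{nonNegative (<⇒≤ (2^-pos (suc m)))}} (1≤2^ (n ℕ.∸ suc m)) ⟩
  2ℚ ^ suc m * 2ℚ ^ (n ℕ.∸ suc m) ≡⟨ sym (^-homo-* 2ℚ (suc m) (n ℕ.∸ suc m)) ⟩
  2ℚ ^ (suc m ℕ.+ (n ℕ.∸ suc m))  ≡⟨ cong (2ℚ ^_) (ℕₚ.m+[n∸m]≡n m<n) ⟩
  2ℚ ^ n                          ∎
  where open ≤-Reasoning

p<q⇒0<q-p : ∀ {p q} → p < q → 0ℚ < q - p
p<q⇒0<q-p {p} {q} p<q = subst (_< q - p) (+-inverseʳ p) (+-monoˡ-< (- p) p<q)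

-- Bernoulli's inequality, homogenised: qⁿ(q + n(r − q)) ≤ rⁿq.
bernoulli : ∀ {q r} → 0ℚ ≤ q → q ≤ r → ∀ n → q ^ n * (q + + n / 1 * (r - q)) ≤ r ^ n * q
bernoulli {q} {r} 0≤q q≤r zero = ≤-reflexive
  (solve 2 (λ q d → con 1ℚ :* (q :+ con 0ℚ :* d) := con 1ℚ :* q) refl q (r - q))
  where open +-*-Solver
bernoulli {q} {r} 0≤q q≤r (suc n) = begin
  q * Q * (q + + suc n / 1 * D)  ≡⟨ cong (λ z → q * Q * (q + z * D)) (sym (frac-+ 1 n 0)) ⟩
  q * Q * (q + (1ℚ + N) * D)     ≡⟨ solve 4 (λ q Q N D → q :* Q :* (q :+ (con 1ℚ :+ N) :* D)
                                      := Q :* (q :* q :+ q :* D :+ q :* N :* D)) refl q Q N D ⟩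
  Q * (q * q + q * D + q * N * D) ≡⟨ sym (+-identityʳ _) ⟩
  Q * (q * q + q * D + q * N * D) + 0ℚ
    ≤⟨ +-monoʳ-≤ (Q * (q * q + q * D + q * N * D)) (*-nonneg (^-nonneg n 0≤q) (*-nonneg 0≤N (*-nonneg 0≤D 0≤D))) ⟩
  Q * (q * q + q * D + q * N * D) + Q * (N * (D * D))
    ≡⟨ solve 4 (λ q Q N r → let D = r :- q in
         Q :* (q :* q :+ q :* D :+ q :* N :* D) :+ Q :* (N :* (D :* D))
         := r :* (Q :* (q :+ N :* D))) refl q Q N r ⟩
  r * (Q * (q + N * D))          ≤⟨ *-monoˡ-≤-nonNeg r {{nonNegative (≤-trans 0≤q q≤r)}} (bernoulli 0≤q q≤r n) ⟩
  r * (r ^ n * q)                ≡⟨ sym (*-assoc r (r ^ n) q) ⟩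
  r * r ^ n * q                  ∎
  where
  open ≤-Reasoning
  open +-*-Solver
  D = r - q
  Q = q ^ n
  N = + n / 1
  0≤D : 0ℚ ≤ D
  0≤D = subst (_≤ D) (+-inverseʳ q) (+-monoˡ-≤ (- q) q≤r)
  0≤N : 0ℚ ≤ N
  0≤N = nonNegative⁻¹ N {{normalize-nonNeg n 1}}

growth′ : ∀ {q r} → 0ℚ < q → q < r → ∃[ b ] 4ℚ * q ^ suc b ≤ r ^ suc b
growth′ {q} {r} 0<q q<r = k , *-cancelʳ-≤-pos q {{positive 0<q}} (begin
    4ℚ * q ^ suc k * q                 ≡⟨ solve 2 (λ q Q → con 4ℚ :* Q :* q := Q :* (q :+ con 3ℚ :* q)) refl q (q ^ suc k) ⟩
    q ^ suc k * (q + 3ℚ * q)           ≡⟨ cong (λ z → q ^ suc k * (q + z)) (sym e) ⟩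
    q ^ suc k * (q + 3ℚ * q * 1/D * D) ≤⟨ *-monoˡ-≤-nonNeg (q ^ suc k) {{nonNegative (<⇒≤ (^-pos (suc k) 0<q))}}
                                          (+-monoʳ-≤ q (*-monoʳ-≤-nonNeg D {{nonNegative (<⇒≤ 0<D)}} (<⇒≤ h))) ⟩
    q ^ suc k * (q + + suc k / 1 * D)  ≤⟨ bernoulli (<⇒≤ 0<q) (<⇒≤ q<r) (suc k) ⟩
    r ^ suc k * q                      ∎)
  where
  open ≤-Reasoning
  open +-*-Solver
  D = r - q
  0<D = p<q⇒0<q-p q<r
  instance _ = pos⇒nonZero D {{positive 0<D}}
  1/D = 1/ D
  kh = archimedean (3ℚ * q * 1/D) 0
  k = proj₁ kh
  h = proj₂ kh
  e : 3ℚ * q * 1/D * D ≡ 3ℚ * q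
  e = *-1/-cancel (3ℚ * q) D

abstract
  growth : ∀ {q r} → 0ℚ < q → q < r → ∃[ b ] 4ℚ * q ^ suc b ≤ r ^ suc b
  growth = growth′

------------------------------------------------------------------------
-- Real numbers

-- An element of [0,∞) is a two-sided Dedekind cut of ℚ; nonnegativity says
-- that every negative rational lies in the lower cut.
record ℝ⁺ : Set₁ where
  field
    lower upper     : ℚ → Set
    lower-negative  : ∀ {q} → q < 0ℚ → lower q
    upper-inhabited : ∃ upper
    lower-down      : ∀ {q r} → q < r → lower r → lower q
    upper-up        : ∀ {q r} → q < r → upper q → upper r
    lower-open      : ∀ {q} → lower q → ∃[ r ] q < r × lower r
    upper-open      : ∀ {r} → upper r → ∃[ q ] q < r × upper q
    disjoint        : ∀ {q} → lower q → ¬ upper q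
    located         : ∀ {q r} → q < r → lower q ⊎ upper r

open ℝ⁺ public

infix 4 _≤ᴿ_ _<ᴿ_ _≈ᴿ_

_≤ᴿ_ : ℝ⁺ → ℝ⁺ → Set
x ≤ᴿ y = ∀ q → lower x q → lower y q

_<ᴿ_ : ℝ⁺ → ℝ⁺ → Set
x <ᴿ y = ∃[ q ] upper x q × lower y q

_≈ᴿ_ : ℝ⁺ → ℝ⁺ → Set
x ≈ᴿ y = x ≤ᴿ y × y ≤ᴿ x

lower<upper : ∀ x {q r} → lower x q → upper x r → q < r
lower<upper x {q} {r} l u with <-cmp q r
... | tri< q<r _ _  = q<r
... | tri≈ _ refl _ = contradiction u (disjoint x l)
... | tri> _ _ r<q  = contradiction (upper-up x r<q u) (disjoint x l)

upper-pos : ∀ x {q} → upper x q → 0ℚ < q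
upper-pos x u with upper-open x u
... | r , r<q , ur with r <? 0ℚ
... | yes r<0 = contradiction ur (disjoint x (lower-negative x r<0))
... | no  r≮0 = ≤-<-trans (≮⇒≥ r≮0) r<q

grid′ : ∀ x b → upper x (+ 1 / suc b) ⊎ ∃[ j ] lower x (+ j / suc b) × upper x (+ (2 ℕ.+ j) / suc b)
grid′ x b = let u , ux = upper-inhabited x ; k , u<k = archimedean u b in
  descend k (upper-up x u<k ux)
  where
  descend : ∀ k → upper x (+ suc k / suc b) →
            upper x (+ 1 / suc b) ⊎ ∃[ j ] lower x (+ j / suc b) × upper x (+ (2 ℕ.+ j) / suc b)
  descend zero    u = inj₁ u
  descend (suc k) u with located x {+ k / suc b} {+ suc k / suc b} (frac-< {k} {b} {suc k} {b} (ℕₚ.*-monoˡ-< (suc b) (ℕₚ.n<1+n k)))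
  ... | inj₁ l  = inj₂ (k , l , u)
  ... | inj₂ u′ = descend k u′

abstract
  grid : ∀ x b → upper x (+ 1 / suc b) ⊎ ∃[ j ] lower x (+ j / suc b) × upper x (+ (2 ℕ.+ j) / suc b)
  grid = grid′

approximate′ : ∀ x {ε} → 0ℚ < ε → ∃[ a ] lower x a × upper x (a + ε)
approximate′ x {ε} 0<ε with small-frac ε 0<ε
... | b , 2/b<ε with grid x b
... | inj₁ u = + 1 / suc b - ε , lower-negative x below0 , subst (upper x) e u
  where
  1/b<ε : + 1 / suc b < ε
  1/b<ε = <-trans (frac-< {1} {b} {2} {b} (ℕₚ.*-monoˡ-< (suc b) (ℕₚ.n<1+n 1))) 2/b<ε
  below0 : + 1 / suc b - ε < 0ℚ
  below0 = subst (+ 1 / suc b - ε <_) (+-inverseʳ ε) (+-monoˡ-< (- ε) 1/b<ε)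
  e : + 1 / suc b ≡ + 1 / suc b - ε + ε
  e = solve 2 (λ p ε → p := p :- ε :+ ε) refl (+ 1 / suc b) ε
    where open +-*-Solver
... | inj₂ (j , l , u) = + j / suc b , l , upper-up x lt u
  where
  lt : + (2 ℕ.+ j) / suc b < + j / suc b + ε
  lt = subst (_< + j / suc b + ε)
         (trans (frac-+ j 2 b) (cong (λ n → + n / suc b) (ℕₚ.+-comm j 2)))
         (+-monoʳ-< (+ j / suc b) 2/b<ε)

abstract
  approximate : ∀ x {ε} → 0ℚ < ε → ∃[ a ] lower x a × upper x (a + ε)
  approximate = approximate′

fromℚ : (p : ℚ) → 0ℚ ≤ p → ℝ⁺
fromℚ p 0≤p = record
  { lower           = _< p
  ; upper           = p <_
  ; lower-negative  = λ q<0 → <-≤-trans q<0 0≤p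
  ; upper-inhabited = p + 1ℚ , subst (_< p + 1ℚ) (+-identityʳ p) (+-monoʳ-< p 0<1)
  ; lower-down      = <-trans
  ; upper-up        = λ q<r p<q → <-trans p<q q<r
  ; lower-open      = λ q<p → let m , q<m , m<p = <-dense q<p in m , q<m , m<p
  ; upper-open      = λ p<r → let m , p<m , m<r = <-dense p<r in m , m<r , p<m
  ; disjoint        = <-asym
  ; located         = loc
  }
  where
  loc : ∀ {q r} → q < r → q < p ⊎ p < r
  loc {q} q<r with q <? p
  ... | yes q<p = inj₁ q<p
  ... | no  q≮p = inj₂ (≤-<-trans (≮⇒≥ q≮p) q<r)

fromℕ : ℕ → ℝ⁺
fromℕ n = fromℚ (+ n / 1) (nonNegative⁻¹ (+ n / 1) {{normalize-nonNeg n 1}})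

infixl 6 _+ᴿ_
infixl 7 _*ᴿ_

_+ᴿ_ : ℝ⁺ → ℝ⁺ → ℝ⁺
x +ᴿ y = record
  { lower           = Lo
  ; upper           = Up
  ; lower-negative  = below0
  ; upper-inhabited = let a , ua = upper-inhabited x ; b , ub = upper-inhabited y in
      a + b + 1ℚ , a , b , ua , ub , subst (_< a + b + 1ℚ) (+-identityʳ (a + b)) (+-monoʳ-< (a + b) 0<1)
  ; lower-down      = λ { q<r (a , b , la , lb , r<) → a , b , la , lb , <-trans q<r r< }
  ; upper-up        = λ { q<r (a , b , ua , ub , <q) → a , b , ua , ub , <-trans <q q<r }
  ; lower-open      = λ { (a , b , la , lb , q<) → let m , q<m , m< = <-dense q< in m , q<m , a , b , la , lb , m< }
  ; upper-open      = λ { (a , b , ua , ub , <r) → let m , <m , m<r = <-dense <r in m , m<r , a , b , ua , ub , <m }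
  ; disjoint        = λ { (a , b , la , lb , q<) (c , d , uc , ud , <q) →
      <-asym (<-trans <q q<) (+-mono-< (lower<upper x la uc) (lower<upper y lb ud)) }
  ; located         = loc
  }
  where
  open +-*-Solver
  Lo Up : ℚ → Set
  Lo q = ∃₂ λ a b → lower x a × lower y b × q < a + b
  Up q = ∃₂ λ a b → upper x a × upper y b × a + b < q
  below0 : ∀ {q} → q < 0ℚ → Lo q
  below0 {q} q<0 with <-dense q<0
  ... | m , q<m , m<0 = ½ * m , ½ * m , lower-negative x hm<0 , lower-negative y hm<0 ,
        subst (q <_) (solve 1 (λ m → m := con ½ :* m :+ con ½ :* m) refl m) q<m
    where
    hm<0 : ½ * m < 0ℚ
    hm<0 = subst (½ * m <_) (*-zeroʳ ½) (*-monoʳ-<-pos ½ m<0)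
  loc : ∀ {q r} → q < r → Lo q ⊎ Up r
  loc {q} {r} q<r with <-dense q<r
  ... | m , q<m , m<r with approximate x (p<q⇒0<q-p m<r)
  ... | a , la , ua with located y (+-monoˡ-< (- a) q<m)
  ... | inj₁ l = let b , q-a<b , lb = lower-open y l in
        inj₁ (a , b , la , lb , subst (_< a + b) (solve 2 (λ a q → a :+ (q :- a) := q) refl a q) (+-monoʳ-< a q-a<b))
  ... | inj₂ u = let b , b<m-a , ub = upper-open y u ; a′ = a + (r - m) in
        inj₂ (a′ , b , ua , ub , subst (a′ + b <_)
          (solve 3 (λ a r m → a :+ (r :- m) :+ (m :- a) := r) refl a r m) (+-monoʳ-< a′ b<m-a))

_*ᴿ_ : ℝ⁺ → ℝ⁺ → ℝ⁺
x *ᴿ y = record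
  { lower           = Lo
  ; upper           = Up
  ; lower-negative  = inj₁
  ; upper-inhabited = let a , ua = upper-inhabited x ; b , ub = upper-inhabited y in
      a * b + 1ℚ , a , b , ua , ub , subst (_< a * b + 1ℚ) (+-identityʳ (a * b)) (+-monoʳ-< (a * b) 0<1)
  ; lower-down      = λ { q<r (inj₁ r<0) → inj₁ (<-trans q<r r<0)
                        ; q<r (inj₂ (a , b , 0≤a , 0≤b , la , lb , r<)) →
                            inj₂ (a , b , 0≤a , 0≤b , la , lb , <-trans q<r r<) }
  ; upper-up        = λ { q<r (a , b , ua , ub , <q) → a , b , ua , ub , <-trans <q q<r }
  ; lower-open      = λ { (inj₁ q<0) → let m , q<m , m<0 = <-dense q<0 in m , q<m , inj₁ m<0
                        ; (inj₂ (a , b , 0≤a , 0≤b , la , lb , q<)) →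
                            let m , q<m , m< = <-dense q< in
                            m , q<m , inj₂ (a , b , 0≤a , 0≤b , la , lb , m<) }
  ; upper-open      = λ { (a , b , ua , ub , <r) → let m , <m , m<r = <-dense <r in m , m<r , a , b , ua , ub , <m }
  ; disjoint        = dis
  ; located         = loc
  }
  where
  open +-*-Solver
  Lo Up : ℚ → Set
  Lo q = q < 0ℚ ⊎ ∃₂ λ a b → 0ℚ ≤ a × 0ℚ ≤ b × lower x a × lower y b × q < a * b
  Up q = ∃₂ λ a b → upper x a × upper y b × a * b < q
  dis : ∀ {q} → Lo q → ¬ Up q
  dis (inj₁ q<0) (c , d , uc , ud , <q) =
    <-asym (<-trans <q q<0) (*-pos (upper-pos x uc) (upper-pos y ud))
  dis (inj₂ (a , b , 0≤a , 0≤b , la , lb , q<)) (c , d , uc , ud , <q) =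
    <-irrefl refl (<-≤-trans (<-trans <q q<)
      (*-mono-≤⁺ 0≤b (<⇒≤ (upper-pos x uc)) (<⇒≤ (lower<upper x la uc)) (<⇒≤ (lower<upper y lb ud))))
  loc : ∀ {q r} → q < r → Lo q ⊎ Up r
  loc {q} {r} q<r with q <? 0ℚ
  ... | yes q<0 = inj₁ (inj₁ q<0)
  ... | no q≮0 with upper-inhabited x | upper-inhabited y
  ... | u , ux | v , vy = go (approximate x 0<ε) (approximate y 0<ε)
    where
    open ≤-Reasoning
    0≤q = ≮⇒≥ q≮0
    0<u = upper-pos x ux
    0<v = upper-pos y vy
    D = r - q
    0<D = p<q⇒0<q-p q<r
    M = u + v + 1ℚ + D
    0<u+v : 0ℚ < u + v
    0<u+v = +-mono-< 0<u 0<v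
    0<K : 0ℚ < u + v + 1ℚ
    0<K = +-mono-< 0<u+v 0<1
    0<M : 0ℚ < M
    0<M = +-mono-< 0<K 0<D
    instance _ = pos⇒nonZero M {{positive 0<M}}
    ε = D * 1/ M
    0<ε : 0ℚ < ε
    0<ε = *-pos 0<D (positive⁻¹ (1/ M) {{1/pos⇒pos M {{positive 0<M}}}})
    0≤ε = <⇒≤ 0<ε
    εM : ε * M ≡ D
    εM = *-1/-cancel D M
    εK<D : ε * (u + v + 1ℚ) < D
    εK<D = begin-strict
      ε * (u + v + 1ℚ)         <⟨ *-monoʳ-<-pos ε {{positive 0<ε}} (subst (_< M) (+-identityʳ (u + v + 1ℚ)) (+-monoʳ-< (u + v + 1ℚ) 0<D)) ⟩
      ε * M                    ≡⟨ εM ⟩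
      D                        ∎
    D<M : D < M
    D<M = subst (_< M) (+-identityˡ D) (+-monoˡ-< D 0<K)
    ε≤1 : ε ≤ 1ℚ
    ε≤1 = *-cancelʳ-≤-pos M {{positive 0<M}} (begin
      ε * M  ≡⟨ εM ⟩
      D      ≤⟨ <⇒≤ D<M ⟩
      M      ≡⟨ sym (*-identityˡ M) ⟩
      1ℚ * M ∎)
    q+εK<r : q + ε * (u + v + 1ℚ) < r
    q+εK<r = subst (q + ε * (u + v + 1ℚ) <_) (solve 2 (λ q r → q :+ (r :- q) := r) refl q r) (+-monoʳ-< q εK<D)
    -- If one factor is below ε, its product with the bound w of the other is below r.
    tiny : ∀ {w} → 0ℚ ≤ w → w ≤ u + v + 1ℚ → ε * w < r
    tiny {w} 0≤w w≤ = begin-strict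
      ε * w                    ≤⟨ *-monoˡ-≤-nonNeg ε {{nonNegative 0≤ε}} w≤ ⟩
      ε * (u + v + 1ℚ)         ≡⟨ sym (+-identityˡ _) ⟩
      0ℚ + ε * (u + v + 1ℚ)    ≤⟨ +-monoˡ-≤ (ε * (u + v + 1ℚ)) 0≤q ⟩
      q + ε * (u + v + 1ℚ)     <⟨ q+εK<r ⟩
      r                        ∎
    u≤K : u ≤ u + v + 1ℚ
    u≤K = begin
      u             ≡⟨ solve 1 (λ u → u := u :+ con 0ℚ :+ con 0ℚ) refl u ⟩
      u + 0ℚ + 0ℚ   ≤⟨ +-mono-≤ (+-monoʳ-≤ u (<⇒≤ 0<v)) 0≤1 ⟩
      u + v + 1ℚ    ∎
    v≤K : v ≤ u + v + 1ℚ
    v≤K = begin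
      v             ≡⟨ solve 1 (λ v → v := con 0ℚ :+ v :+ con 0ℚ) refl v ⟩
      0ℚ + v + 0ℚ   ≤⟨ +-mono-≤ (+-monoˡ-≤ v (<⇒≤ 0<u)) 0≤1 ⟩
      u + v + 1ℚ    ∎
    go : (∃[ a ] lower x a × upper x (a + ε)) → (∃[ b ] lower y b × upper y (b + ε)) → Lo q ⊎ Up r
    go (a , la , ua) (b , lb , ub) with a <? 0ℚ | b <? 0ℚ
    ... | yes a<0 | _ = inj₂ (a + ε , v , ua , vy , (begin-strict
          (a + ε) * v  <⟨ *-monoˡ-<-pos v {{positive 0<v}} (+-monoˡ-< ε a<0) ⟩
          (0ℚ + ε) * v ≡⟨ cong (_* v) (+-identityˡ ε) ⟩
          ε * v        <⟨ tiny (<⇒≤ 0<v) v≤K ⟩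
          r            ∎))
    ... | no _ | yes b<0 = inj₂ (u , b + ε , ux , ub , (begin-strict
          u * (b + ε)  <⟨ *-monoʳ-<-pos u {{positive 0<u}} (+-monoˡ-< ε b<0) ⟩
          u * (0ℚ + ε) ≡⟨ trans (cong (u *_) (+-identityˡ ε)) (*-comm u ε) ⟩
          ε * u        <⟨ tiny (<⇒≤ 0<u) u≤K ⟩
          r            ∎))
    ... | no a≮0 | no b≮0 with q <? a * b
    ... | yes q<ab = inj₁ (inj₂ (a , b , ≮⇒≥ a≮0 , ≮⇒≥ b≮0 , la , lb , q<ab))
    ... | no q≮ab = inj₂ (a + ε , b + ε , ua , ub , (begin-strict
          (a + ε) * (b + ε)         ≡⟨ solve 3 (λ a b e → (a :+ e) :* (b :+ e) := a :* b :+ e :* (a :+ b :+ e)) refl a b ε ⟩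
          a * b + ε * (a + b + ε)   ≤⟨ +-mono-≤ (≮⇒≥ q≮ab) (*-monoˡ-≤-nonNeg ε {{nonNegative 0≤ε}}
                                         (+-mono-≤ (+-mono-≤ (<⇒≤ (lower<upper x la ux)) (<⇒≤ (lower<upper y lb vy))) ε≤1)) ⟩
          q + ε * (u + v + 1ℚ)      <⟨ q+εK<r ⟩
          r                         ∎))

infix 8 2^-_

-- 2^- s is the real 2⁻ˢ.  Its cuts are the strict lower and upper bounds
-- obtained from 2^(−p) for rationals p = a/(1+b) with s < p and p < s,
-- where q ≤ 2^(−a/(1+b)) is expressed as q^(1+b) · 2^a ≤ 1.
-- As a ranges over ℕ, the bounds above 1 have to be added to the upper cut.
2^-_ : ℝ⁺ → ℝ⁺
2^- s = record
  { lower           = Lo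
  ; upper           = Up
  ; lower-negative  = below0
  ; upper-inhabited = 2ℚ , inj₁ 1<2
  ; lower-down      = λ { q<r (t , a , b , r<t , rest) → t , a , b , <-trans q<r r<t , rest }
  ; upper-up        = λ { q<r (inj₁ 1<q) → inj₁ (<-trans 1<q q<r)
                        ; q<r (inj₂ (t , a , b , t<q , rest)) → inj₂ (t , a , b , <-trans t<q q<r , rest) }
  ; lower-open      = λ { (t , a , b , q<t , rest) → let m , q<m , m<t = <-dense q<t in m , q<m , t , a , b , m<t , rest }
  ; upper-open      = λ { (inj₁ 1<r) → let m , 1<m , m<r = <-dense 1<r in m , m<r , inj₁ 1<m
                        ; (inj₂ (t , a , b , t<r , rest)) → let m , t<m , m<r = <-dense t<r in
                            m , m<r , inj₂ (t , a , b , t<m , rest) }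
  ; disjoint        = dis
  ; located         = loc
  }
  where
  open ≤-Reasoning
  open +-*-Solver
  Lo Up : ℚ → Set
  Lo q = ∃[ t ] ∃₂ λ a b → q < t × 0ℚ ≤ t × upper s (+ a / suc b) × t ^ suc b * 2ℚ ^ a ≤ 1ℚ
  Up q = 1ℚ < q ⊎ ∃[ t ] ∃₂ λ a b → t < q × 0ℚ < t × lower s (+ a / suc b) × 1ℚ ≤ t ^ suc b * 2ℚ ^ a

  below0 : ∀ {q} → q < 0ℚ → Lo q
  below0 q<0 = let u , us = upper-inhabited s ; k , u<k = archimedean u 0 in
    0ℚ , suc k , 0 , q<0 , ≤-refl , upper-up s u<k us ,
    subst (_≤ 1ℚ) (sym (trans (cong (_* 2ℚ ^ suc k) (*-zeroˡ 1ℚ)) (*-zeroˡ (2ℚ ^ suc k)))) 0≤1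

  power-product : ∀ t B a C → (t ^ B * 2ℚ ^ a) ^ C ≡ t ^ (B ℕ.* C) * 2ℚ ^ (a ℕ.* C)
  power-product t B a C = trans (^-distrib-* (t ^ B) (2ℚ ^ a) C)
    (cong₂ _*_ (^-assocʳ t B C) (^-assocʳ 2ℚ a C))

  dis : ∀ {q} → Lo q → ¬ Up q
  dis {q} (t , a , b , q<t , 0≤t , _ , tb≤1) (inj₁ 1<q) = <-irrefl refl (begin-strict
    1ℚ                ≡⟨ sym (*-identityʳ 1ℚ) ⟩
    1ℚ * 1ℚ           <⟨ *-monoˡ-<-pos 1ℚ (<-trans 1<q q<t) ⟩
    t * 1ℚ            ≤⟨ *-monoˡ-≤-nonNeg t {{nonNegative 0≤t}} (subst (_≤ t ^ b) (1^ b) (^-mono b 0≤1 (<⇒≤ (<-trans 1<q q<t)))) ⟩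
    t * t ^ b         ≡⟨ sym (*-identityʳ _) ⟩
    t ^ suc b * 1ℚ    ≤⟨ *-monoˡ-≤-nonNeg (t ^ suc b) {{nonNegative (^-nonneg (suc b) 0≤t)}} (1≤2^ a) ⟩
    t ^ suc b * 2ℚ ^ a ≤⟨ tb≤1 ⟩
    1ℚ                ∎)
  dis {q} (t , a , b , q<t , 0≤t , us , tb≤1) (inj₂ (t′ , a′ , b′ , t′<q , 0<t′ , ls , 1≤tb′)) = <-irrefl refl (begin-strict
    1ℚ                                      ≡⟨ sym (1^ B) ⟩
    1ℚ ^ B                                  ≤⟨ ^-mono B 0≤1 1≤tb′ ⟩
    (t′ ^ B′ * 2ℚ ^ a′) ^ B                 ≡⟨ power-product t′ B′ a′ B ⟩
    t′ ^ (B′ ℕ.* B) * 2ℚ ^ (a′ ℕ.* B)       <⟨ *-monoʳ-<-pos (t′ ^ (B′ ℕ.* B)) {{positive (^-pos (B′ ℕ.* B) 0<t′)}}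
                                                 (2^-mono-< (frac-<⁻¹ {a′} {b′} {a} {b} (lower<upper s ls us))) ⟩
    t′ ^ (B′ ℕ.* B) * 2ℚ ^ (a ℕ.* B′)       ≤⟨ *-monoʳ-≤-nonNeg (2ℚ ^ (a ℕ.* B′)) {{nonNegative (<⇒≤ (2^-pos (a ℕ.* B′)))}}
                                                 (^-mono (B′ ℕ.* B) (<⇒≤ 0<t′) (<⇒≤ (<-trans t′<q q<t))) ⟩
    t ^ (B′ ℕ.* B) * 2ℚ ^ (a ℕ.* B′)        ≡⟨ cong (λ n → t ^ n * 2ℚ ^ (a ℕ.* B′)) (ℕₚ.*-comm B′ B) ⟩
    t ^ (B ℕ.* B′) * 2ℚ ^ (a ℕ.* B′)        ≡⟨ sym (power-product t B a B′) ⟩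
    (t ^ B * 2ℚ ^ a) ^ B′                   ≤⟨ ^-mono B′ (*-nonneg (^-nonneg B 0≤t) (<⇒≤ (2^-pos a))) tb≤1 ⟩
    1ℚ ^ B′                                 ≡⟨ 1^ B′ ⟩
    1ℚ                                      ∎)
    where
    B = suc b
    B′ = suc b′

  loc : ∀ {q r} → q < r → Lo q ⊎ Up r
  loc {q} {r} q<r with q <? 0ℚ
  ... | yes q<0 = inj₁ (below0 q<0)
  ... | no q≮0 with <-dense q<r
  ... | m , q<m , m<r with <-dense m<r
  ... | m′ , m<m′ , m′<r with growth (≤-<-trans (≮⇒≥ q≮0) q<m) m<m′
  ... | b , 4m≤m′ = go (grid s b)
    where
    B = suc b
    0<m = ≤-<-trans (≮⇒≥ q≮0) q<m
    0<m′ = <-trans 0<m m<m′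
    go : upper s (+ 1 / B) ⊎ ∃[ j ] lower s (+ j / B) × upper s (+ (2 ℕ.+ j) / B) → Lo q ⊎ Up r
    go (inj₁ u) with m ^ B * 2ℚ ^ 1 ≤? 1ℚ
    ... | yes h = inj₁ (m , 1 , b , q<m , <⇒≤ 0<m , u , h)
    ... | no  h with m′ ≤? 1ℚ
    ... | no  m′≰1 = inj₂ (inj₁ (<-trans (≰⇒> m′≰1) m′<r))
    ... | yes m′≤1 = contradiction (≰⇒> h) (≤⇒≯ (begin
          m ^ B * 2ℚ ^ 1   ≤⟨ *-monoˡ-≤-nonNeg (m ^ B) {{nonNegative (^-nonneg B (<⇒≤ 0<m))}} (≤ᵇ⇒≤ _) ⟩
          m ^ B * 4ℚ       ≡⟨ *-comm (m ^ B) 4ℚ ⟩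
          4ℚ * m ^ B       ≤⟨ 4m≤m′ ⟩
          m′ ^ B           ≤⟨ ^-mono B (<⇒≤ 0<m′) m′≤1 ⟩
          1ℚ ^ B           ≡⟨ 1^ B ⟩
          1ℚ               ∎))
      where
      ≤⇒≯ : ∀ {p q} → p ≤ q → ¬ q < p
      ≤⇒≯ p≤q q<p = <-irrefl refl (<-≤-trans q<p p≤q)
    go (inj₂ (j , l , u)) with m ^ B * 2ℚ ^ (2 ℕ.+ j) ≤? 1ℚ
    ... | yes h = inj₁ (m , 2 ℕ.+ j , b , q<m , <⇒≤ 0<m , u , h)
    ... | no  h = inj₂ (inj₂ (m′ , j , b , m′<r , 0<m′ , l , (begin
          1ℚ                           ≤⟨ <⇒≤ (≰⇒> h) ⟩
          m ^ B * 2ℚ ^ (2 ℕ.+ j)       ≡⟨ solve 2 (λ x y → x :* (con 2ℚ :* (con 2ℚ :* y)) := con 4ℚ :* x :* y) refl (m ^ B) (2ℚ ^ j) ⟩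
          4ℚ * m ^ B * 2ℚ ^ j          ≤⟨ *-monoʳ-≤-nonNeg (2ℚ ^ j) {{nonNegative (<⇒≤ (2^-pos j))}} 4m≤m′ ⟩
          m′ ^ B * 2ℚ ^ j              ∎)))

------------------------------------------------------------------------
-- Extended real numbers

-- An element x of [−∞,∞] is given by its upper cut {q ∈ ℚ ∣ x < q}; the empty
-- cut is ∞ and the full cut is −∞.  Infima and suprema then always exist.
record ℝ∞ : Set₂ where
  field
    above      : ℚ → Set₁
    above-up   : ∀ {q r} → q < r → above q → above r
    above-open : ∀ {r} → above r → ∃[ q ] q < r × above q

open ℝ∞ public

infix 4 _≈∞_

_≈∞_ : ℝ∞ → ℝ∞ → Set₁
x ≈∞ y = ∀ q → above x q ⇔ above y q

infimum : (ℝ⁺ → Set₁) → ℝ∞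
infimum A = record
  { above      = λ q → ∃[ s ] A s × upper s q
  ; above-up   = λ { q<r (s , As , u) → s , As , upper-up s q<r u }
  ; above-open = λ { (s , As , u) → let q , q<r , u′ = upper-open s u in q , q<r , s , As , u′ }
  }

inf sup : (ℕ → ℝ∞) → ℝ∞
inf x = record
  { above      = λ q → ∃[ n ] above (x n) q
  ; above-up   = λ { q<r (n , a) → n , above-up (x n) q<r a }
  ; above-open = λ { (n , a) → let q , q<r , a′ = above-open (x n) a in q , q<r , n , a′ }
  }
-- A supremum lies strictly below q when the xₙ have an upper bound smaller than q.
sup x = record
  { above      = λ q → ∃[ r ] r < q × (∀ n → above (x n) r)
  ; above-up   = λ { q<r (b , b<q , h) → b , <-trans b<q q<r , h }
  ; above-open = λ { (b , b<r , h) → let m , b<m , m<r = <-dense b<r in m , m<r , b , b<m , h }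
  }

liminf : (ℕ → ℝ∞) → ℝ∞
liminf x = sup λ n → inf λ k → x (n ℕ.+ k)

-- lim supₙ xₙ = ∞: every tail of the sequence is unbounded.
Limsup≡∞ : (ℕ → ℝ⁺) → Set
Limsup≡∞ x = ∀ (M : ℚ) n → ∃[ k ] n ℕ.≤ k × lower (x k) M

------------------------------------------------------------------------
-- Computability

-- Partial recursive functions of n arguments, as Kleene's μ-recursive terms.
data Rec : ℕ → Set where
  zero : ∀ {n} → Rec n
  succ : Rec 1
  proj : ∀ {n} → Fin n → Rec n
  comp : ∀ {m n} → Rec m → Vec (Rec n) m → Rec n
  prec : ∀ {n} → Rec n → Rec (2 ℕ.+ n) → Rec (suc n)
  mu   : ∀ {n} → Rec (suc n) → Rec n

infix 4 _[_]⇓_ _[_]⇓*_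

mutual
  data _[_]⇓_ : ∀ {n} → Rec n → Vec ℕ n → ℕ → Set where
    zero⇓ : ∀ {n} {xs : Vec ℕ n} → zero [ xs ]⇓ 0
    succ⇓ : ∀ {x} → succ [ x ∷ [] ]⇓ suc x
    proj⇓ : ∀ {n} {i : Fin n} {xs} → proj i [ xs ]⇓ lookup xs i
    comp⇓ : ∀ {m n} {f : Rec m} {gs : Vec (Rec n) m} {xs ys z} →
            gs [ xs ]⇓* ys → f [ ys ]⇓ z → comp f gs [ xs ]⇓ z
    prec-zero⇓ : ∀ {n} {f : Rec n} {g xs z} →
                 f [ xs ]⇓ z → prec f g [ 0 ∷ xs ]⇓ z
    prec-suc⇓  : ∀ {n} {f : Rec n} {g xs k y z} →
                 prec f g [ k ∷ xs ]⇓ y → g [ k ∷ y ∷ xs ]⇓ z → prec f g [ suc k ∷ xs ]⇓ z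
    mu⇓ : ∀ {n} {f : Rec (suc n)} {xs y} →
          (∀ i → i ℕ.< y → ∃[ z ] f [ i ∷ xs ]⇓ suc z) → f [ y ∷ xs ]⇓ 0 → mu f [ xs ]⇓ y

  data _[_]⇓*_ {n} : ∀ {m} → Vec (Rec n) m → Vec ℕ n → Vec ℕ m → Set where
    []⇓ : ∀ {xs} → [] [ xs ]⇓* []
    ∷⇓  : ∀ {m} {g : Rec n} {gs : Vec (Rec n) m} {xs y ys} →
          g [ xs ]⇓ y → gs [ xs ]⇓* ys → (g ∷ gs) [ xs ]⇓* (y ∷ ys)

-- f̂ : D × ℕ → ℚ, where D is coded by natural numbers, is computable if there
-- are recursive functions σ, α, β with f̂(x,t) = (−1)^σ(x,t) · α(x,t) / (1 + β(x,t)).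
record Computable {D : Set} (code : D → ℕ) (f̂ : D → ℕ → ℚ) : Set where
  field
    σ α β : D → ℕ → ℕ
    σ-rec α-rec β-rec : Rec 2
    σ-computed : ∀ x t → σ-rec [ code x ∷ t ∷ [] ]⇓ σ x t
    α-computed : ∀ x t → α-rec [ code x ∷ t ∷ [] ]⇓ α x t
    β-computed : ∀ x t → β-rec [ code x ∷ t ∷ [] ]⇓ β x t
    value      : ∀ x t → f̂ x t ≡ ((-1ℤ ℤ.^ σ x t) ℤ.* + α x t) / suc (β x t)

record LowerSemicomputable {D : Set} (code : D → ℕ) (f : D → ℝ⁺) : Set where
  field
    f̂          : D → ℕ → ℚ
    computable : Computable code f̂
    monotone   : ∀ x t → f̂ x t ≤ f̂ x (suc t)
    below      : ∀ x t → lower (f x) (f̂ x t)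
    converges  : ∀ x ε → 0ℚ < ε → ∃[ T ] (∀ t → T ℕ.≤ t →
                   lower (f x) (f̂ x t - ε) × upper (f x) (f̂ x t + ε))

------------------------------------------------------------------------
-- Dimension of sequences

String : Set
String = List Bool

-- The bijection of {0,1}* with ℕ given by bijective base-2 numerals.
codeString : String → ℕ
codeString []          = 0
codeString (false ∷ w) = 1 ℕ.+ 2 ℕ.* codeString w
codeString (true ∷ w)  = 2 ℕ.+ 2 ℕ.* codeString w

Cantor : Set
Cantor = ℕ → Bool

infix 9 _↾_

_↾_ : Cantor → ℕ → String
S ↾ n = applyUpTo S n

IsSupergale : ℝ⁺ → (String → ℝ⁺) → Set
IsSupergale s d = ∀ w → 2^- s *ᴿ (d (w ∷ʳ false) +ᴿ d (w ∷ʳ true)) ≤ᴿ d w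

Succeeds : (String → ℝ⁺) → Cantor → Set
Succeeds d S = Limsup≡∞ (λ n → d (S ↾ n))

dimSequence : Cantor → ℝ∞
dimSequence S = infimum λ s →
  ∃[ d ] IsSupergale s d × LowerSemicomputable codeString d × Succeeds d S

------------------------------------------------------------------------
-- Dimension of strings

data TString : Set where
  str : String → TString
  _□  : String → TString

∣_∣ᵀ : TString → ℕ
∣ str w ∣ᵀ = length w
∣ w □ ∣ᵀ   = suc (length w)

codeTString : TString → ℕ
codeTString (str w) = 2 ℕ.* codeString w
codeTString (w □)   = 1 ℕ.+ 2 ℕ.* codeString w

record IsTermgaleAt (s : ℝ⁺) (d : TString → ℝ⁺) : Set where
  field
    initial : d (str []) ≤ᴿ fromℕ 1
    average : ∀ w → 2^- s *ᴿ (d (str (w ∷ʳ false)) +ᴿ d (str (w ∷ʳ true)) +ᴿ d (w □)) ≤ᴿ d (str w)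

record Termgale : Set₁ where
  field
    gale       : ℝ⁺ → TString → ℝ⁺
    isTermgale : ∀ s → IsTermgaleAt s (gale s)
    coherent   : ∀ s s′ x → 2^- (s *ᴿ fromℕ ∣ x ∣ᵀ) *ᴿ gale s x
                          ≈ᴿ 2^- (s′ *ᴿ fromℕ ∣ x ∣ᵀ) *ᴿ gale s′ x

open Termgale public

IsConstructive : Termgale → Set
IsConstructive d = LowerSemicomputable codeTString (gale d (fromℕ 0))

record IsOptimal (d̃ : Termgale) : Set₁ where
  field
    constructive : IsConstructive d̃
    dominates    : ∀ d → IsConstructive d →
                   ∃[ α ] fromℕ 0 <ᴿ α × (∀ s w → α *ᴿ gale d s (w □) ≤ᴿ gale d̃ s (w □))

dimString : Termgale → String → ℝ∞
dimString d□ w = infimum λ s → Lift (lsuc 0ℓ) (fromℕ 1 <ᴿ gale d□ s (w □))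

{-# OPTIONS --safe #-}
module Submission where

-- A termgale at s = 0 is a measure μ with μ(w) ≥ μ(w0) + μ(w1) + μ(w□).
--
-- dim(S) ≤ lim inf: if 𝐝^(t)(w□) > 1 with t < r, then μ(w) ≥ μ(w□) > 2^(−r(|w|+1)),
-- so the supergale β^|w| μ(w), where 2^r < β ≤ 2^s, is unbounded along S.
--
-- lim inf ≤ dim(S): a supergale d that succeeds on S is discounted to the measure
-- κ τ^|w| d(w) with τ = θρ, ρ ≤ 2^(−s) and θ < 1; the factor θ leaves the mass
-- κ (1 − θ) τ^|w| d(w) for w□.  If 2^(−p) ≤ τ, the p-termgale obtained from it is
-- at least a constant times d(w) at w□, hence so is 𝐝^(p)(w□) by optimality.
--
-- All scaling factors are rational, so they are computed exactly; they exist since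
-- there are rationals ρ and θ < 1 with 2^(−q) ≤ θρ < ρ ≤ 2^(−r) whenever r < q.

open import Data.Bool.Base using (true; false)
open import Data.Fin.Base using (Fin; zero; suc)
open import Data.Fin.Patterns using (0F; 1F; 2F)
open import Data.Integer.Base as ℤ using (+_; -1ℤ)
import Data.Integer.Properties as ℤₚ
open import Data.List.Base using ([]; _∷_; _∷ʳ_; length)
open import Data.List.Properties using (length-++; length-applyUpTo)
open import Data.Nat.Base as ℕ using (ℕ; zero; suc)
import Data.Nat.Properties as ℕₚ
open import Data.Product.Base using (Σ-syntax; ∃-syntax; ∃₂; _×_; _,_; proj₁; proj₂; swap)
open import Data.Rational.Base hiding (_≃_)
open import Data.Rational.Properties
open import Data.Rational.Solver using (module +-*-Solver)
import Data.Rational.Unnormalised.Base as ℚᵘ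
import Data.Rational.Unnormalised.Properties as ℚᵘₚ
open import Data.Sum.Base using (_⊎_; inj₁; inj₂)
open import Data.Vec.Base using (Vec; []; _∷_; lookup)
open import Function.Bundles using (mk⇔)
open import Level using (lift)
open import Relation.Binary.Bundles using (Poset)
open import Relation.Binary.PropositionalEquality
open import Relation.Nullary using (¬_; yes; no; contradiction)

open import Defs

-- Both dimensions are compared through upper cuts, which are open: a rational `q` above one side
-- leaves further rationals in between, and every loss is paid out of this room. The room is
-- indispensable, since a weight 2^(s|w|) with a real s would in general destroy lower
-- semicomputability, while powers of a rational have recursive numerators and denominators. The
-- exponent at which the termgale exceeds 1 on a prefix varies with the prefix; one rational r above
-- all the exponents used yields a single ρ for all of them. Against this ρ the supergale gains the
-- factor 1/θ per bit, and the symbol □, which counts in the length, costs one further factor ρ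
-- only. In the other direction two constants cannot be controlled: the one from optimality and the
-- one that brings d(λ) down to 1. They do no harm, because a supergale that succeeds exceeds every
-- bound, whereas the termgale merely has to exceed 1.

-- Upper cuts of sums and products need no case distinction on signs, hence
-- the order is compared on upper cuts; the record makes x and y inferable.
infix 4 _⊑_ _≅_

record _⊑_ (x y : ℝ⁺) : Set where
  constructor upper⊆
  field upper-⊆ : ∀ {q} → upper y q → upper x q

open _⊑_

_≅_ : ℝ⁺ → ℝ⁺ → Set
x ≅ y = x ⊑ y × y ⊑ x

-- Openness gives room above `q`, and locatedness of `y` in this room decides the matter; one of its
-- two answers contradicts disjointness of the cuts of `x`.
⊑⇒≤ᴿ : ∀ {x y} → x ⊑ y → x ≤ᴿ y
⊑⇒≤ᴿ {x} {y} x⊑y q l with lower-open x l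
... | r , q<r , l′ with located y q<r
... | inj₁ l″ = l″
... | inj₂ u  = contradiction (upper-⊆ x⊑y u) (disjoint x l′)

≤ᴿ⇒⊑ : ∀ {x y} → x ≤ᴿ y → x ⊑ y
≤ᴿ⇒⊑ {x} {y} x≤y = upper⊆ go
  where
  go : ∀ {q} → upper y q → upper x q
  go u with upper-open y u
  ... | r , r<q , u′ with located x r<q
  ... | inj₁ l  = contradiction u′ (disjoint y (x≤y r l))
  ... | inj₂ u″ = u″

⊑-refl : ∀ {x} → x ⊑ x
⊑-refl = upper⊆ λ u → u

⊑-trans : ∀ {x y z} → x ⊑ y → y ⊑ z → x ⊑ z
⊑-trans x⊑y y⊑z = upper⊆ λ u → upper-⊆ x⊑y (upper-⊆ y⊑z u)

≅-refl : ∀ {x} → x ≅ x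
≅-refl = ⊑-refl , ⊑-refl

≅-trans : ∀ {x y z} → x ≅ y → y ≅ z → x ≅ z
≅-trans (a , b) (c , d) = ⊑-trans a c , ⊑-trans d b

⊑-poset : Poset _ _ _
⊑-poset = record
  { Carrier = ℝ⁺
  ; _≈_     = _≅_
  ; _≤_     = _⊑_
  ; isPartialOrder = record
    { isPreorder = record
      { isEquivalence = record { refl = ≅-refl ; sym = swap ; trans = ≅-trans }
      ; reflexive     = proj₁
      ; trans         = ⊑-trans
      }
    ; antisym = _,_
    }
  }

module ⊑-Reasoning where
  open import Relation.Binary.Reasoning.PartialOrder ⊑-poset public

lower-⊆ : ∀ {x y} → x ⊑ y → ∀ {q} → lower x q → lower y q
lower-⊆ x⊑y = ⊑⇒≤ᴿ x⊑y _

*-mono-<⁺ : ∀ {a b c d} → 0ℚ < c → 0ℚ ≤ b → a < b → c ≤ d → a * c < b * d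
*-mono-<⁺ {a} {b} {c} {d} 0<c 0≤b a<b c≤d = <-≤-trans
  (*-monoˡ-<-pos c {{positive 0<c}} a<b)
  (*-monoˡ-≤-nonNeg b {{nonNegative 0≤b}} c≤d)

-- Arithmetic of nonnegative reals

-- Opaque, so that equations between reals are compared syntactically and not
-- as records of cuts.
infix  8 2⁻_
infixl 7 _⊗_
infixl 6 _⊕_

opaque
  _⊕_ _⊗_ : ℝ⁺ → ℝ⁺ → ℝ⁺
  _⊕_ = _+ᴿ_
  _⊗_ = _*ᴿ_

  2⁻_ : ℝ⁺ → ℝ⁺
  2⁻_ = 2^-_

  ν : ℕ → ℝ⁺
  ν = fromℕ

opaque
  unfolding _⊕_ _⊗_

  ⊗-mono : ∀ {x x′ y y′} → x ⊑ x′ → y ⊑ y′ → x ⊗ y ⊑ x′ ⊗ y′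
  ⊗-mono x⊑ y⊑ = upper⊆ λ (a , b , ua , ub , ab<q) → a , b , upper-⊆ x⊑ ua , upper-⊆ y⊑ ub , ab<q

  ⊗-cong : ∀ {x x′ y y′} → x ≅ x′ → y ≅ y′ → x ⊗ y ≅ x′ ⊗ y′
  ⊗-cong (a , b) (c , d) = ⊗-mono a c , ⊗-mono b d

  ⊕-mono : ∀ {x x′ y y′} → x ⊑ x′ → y ⊑ y′ → x ⊕ y ⊑ x′ ⊕ y′
  ⊕-mono x⊑ y⊑ = upper⊆ λ (a , b , ua , ub , a+b<q) → a , b , upper-⊆ x⊑ ua , upper-⊆ y⊑ ub , a+b<q

  ⊕-cong : ∀ {x x′ y y′} → x ≅ x′ → y ≅ y′ → x ⊕ y ≅ x′ ⊕ y′
  ⊕-cong (a , b) (c , d) = ⊕-mono a c , ⊕-mono b d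

  x⊑x+y : ∀ x y → x ⊑ x ⊕ y
  x⊑x+y x y = upper⊆ λ (a , b , ua , ub , a+b<q) → upper-up x (<-trans
    (subst (_< a + b) (+-identityʳ a) (+-monoʳ-< a (upper-pos y ub))) a+b<q) ua

  y⊑x+y : ∀ x y → y ⊑ x ⊕ y
  y⊑x+y x y = upper⊆ λ (a , b , ua , ub , a+b<q) → upper-up y (<-trans
    (subst (_< a + b) (+-identityˡ b) (+-monoˡ-< b (upper-pos x ua))) a+b<q) ub

  ⊗-comm : ∀ x y → x ⊗ y ≅ y ⊗ x
  ⊗-comm x y = go x y , go y x
    where
    go : ∀ x y → x ⊗ y ⊑ y ⊗ x
    go x y = upper⊆ λ (a , b , ua , ub , ab<q) → b , a , ub , ua , subst (_< _) (*-comm a b) ab<q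

  -- Membership in the cut of a product is a strict inequality, so a bound of the inner product
  -- needs slack; it comes from replacing one factor by a smaller upper bound.
  ⊗-assoc : ∀ x y z → (x ⊗ y) ⊗ z ≅ x ⊗ (y ⊗ z)
  ⊗-assoc x y z = upper⊆ to , upper⊆ from
    where
    open ≤-Reasoning
    to : ∀ {q} → upper (x ⊗ (y ⊗ z)) q → upper ((x ⊗ y) ⊗ z) q
    to {q} (a , b , ua , (c , d , uc , ud , cd<b) , ab<q) with upper-open x ua
    ... | a′ , a′<a , ua′ = a * c , d , (a′ , c , ua′ , uc , *-monoˡ-<-pos c {{positive (upper-pos y uc)}} a′<a) , ud ,
      (begin-strict
        a * c * d   ≡⟨ *-assoc a c d ⟩
        a * (c * d) <⟨ *-monoʳ-<-pos a {{positive (upper-pos x ua)}} cd<b ⟩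
        a * b       <⟨ ab<q ⟩
        q           ∎)
    from : ∀ {q} → upper ((x ⊗ y) ⊗ z) q → upper (x ⊗ (y ⊗ z)) q
    from {q} (a , b , (c , d , uc , ud , cd<a) , ub , ab<q) with upper-open z ub
    ... | b′ , b′<b , ub′ = c , d * b , uc , (d , b′ , ud , ub′ , *-monoʳ-<-pos d {{positive (upper-pos y ud)}} b′<b) ,
      (begin-strict
        c * (d * b) ≡⟨ sym (*-assoc c d b) ⟩
        c * d * b   <⟨ *-monoˡ-<-pos b {{positive (upper-pos z ub)}} cd<a ⟩
        a * b       <⟨ ab<q ⟩
        q           ∎)

  ⊗-distribʳ : ∀ z x y → (x ⊕ y) ⊗ z ≅ x ⊗ z ⊕ y ⊗ z
  ⊗-distribʳ z x y = upper⊆ to , upper⊆ from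
    where
    open ≤-Reasoning
    bounded : ∀ {a b c d p r q m} → 0ℚ < a → 0ℚ < c → m ≤ b → m ≤ d →
              a * b < p → c * d < r → p + r < q → (a + c) * m < q
    bounded {a} {b} {c} {d} {p} {r} {q} {m} 0<a 0<c m≤b m≤d ab<p cd<r p+r<q = begin-strict
      (a + c) * m   ≡⟨ *-distribʳ-+ m a c ⟩
      a * m + c * m ≤⟨ +-mono-≤ (*-monoˡ-≤-nonNeg a {{nonNegative (<⇒≤ 0<a)}} m≤b) (*-monoˡ-≤-nonNeg c {{nonNegative (<⇒≤ 0<c)}} m≤d) ⟩
      a * b + c * d <⟨ +-mono-< ab<p cd<r ⟩
      p + r         <⟨ p+r<q ⟩
      q             ∎
    to : ∀ {q} → upper (x ⊗ z ⊕ y ⊗ z) q → upper ((x ⊕ y) ⊗ z) q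
    to {q} (p , r , (a , b , ua , ub , ab<p) , (c , d , uc , ud , cd<r) , p+r<q) with upper-open x ua
    -- The two products come with different upper bounds `b` and `d` of `z`; their minimum is an
    -- upper bound of `z` that serves both.
    ... | a′ , a′<a , ua′ = a + c , b ⊓ d , (a′ , c , ua′ , uc , +-monoˡ-< c a′<a) , um ,
          bounded (upper-pos x ua) (upper-pos y uc) (p⊓q≤p b d) (p⊓q≤q b d) ab<p cd<r p+r<q
      where
      um : upper z (b ⊓ d)
      um with ⊓-sel b d
      ... | inj₁ e = subst (upper z) (sym e) ub
      ... | inj₂ e = subst (upper z) (sym e) ud
    from : ∀ {q} → upper ((x ⊕ y) ⊗ z) q → upper (x ⊗ z ⊕ y ⊗ z) q
    from {q} (e , b , (a , c , ua , uc , a+c<e) , ub , eb<q) with upper-open z ub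
    ... | b′ , b′<b , ub′ = a * b , c * b ,
      (a , b′ , ua , ub′ , *-monoʳ-<-pos a {{positive (upper-pos x ua)}} b′<b) ,
      (c , b′ , uc , ub′ , *-monoʳ-<-pos c {{positive (upper-pos y uc)}} b′<b) , (begin-strict
        a * b + c * b ≡⟨ sym (*-distribʳ-+ b a c) ⟩
        (a + c) * b   <⟨ *-monoˡ-<-pos b {{positive (upper-pos z ub)}} a+c<e ⟩
        e * b         <⟨ eb<q ⟩
        q             ∎)

⊗-distribˡ : ∀ z x y → z ⊗ (x ⊕ y) ≅ z ⊗ x ⊕ z ⊗ y
⊗-distribˡ z x y = ≅-trans (⊗-comm z (x ⊕ y))
  (≅-trans (⊗-distribʳ z x y) (⊕-cong (⊗-comm x z) (⊗-comm y z)))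

-- Rationals as reals

-- Total and opaque, so that positivity proofs do not occur in types and
-- rational arithmetic is not unfolded; negative rationals are sent to 0.
abstract
  ι : ℚ → ℝ⁺
  ι p = fromℚ (0ℚ ⊔ p) (p≤p⊔q 0ℚ p)

  ι-lower : ∀ {p q} → q < p → lower (ι p) q
  ι-lower {p} q<p = <-≤-trans q<p (p≤q⊔p 0ℚ p)

  ι-lower⁻¹ : ∀ {p q} → 0ℚ ≤ p → lower (ι p) q → q < p
  ι-lower⁻¹ 0≤p l = subst (_ <_) (p≤q⇒p⊔q≡q 0≤p) l

  ι-upper : ∀ {p q} → 0ℚ ≤ p → p < q → upper (ι p) q
  ι-upper {_} {q} 0≤p p<q = subst (_< q) (sym (p≤q⇒p⊔q≡q 0≤p)) p<q

  ι-upper⁻¹ : ∀ {p q} → upper (ι p) q → p < q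
  ι-upper⁻¹ {p} u = ≤-<-trans (p≤q⊔p 0ℚ p) u

ι≅fromℚ : ∀ {p} (0≤p : 0ℚ ≤ p) → ι p ≅ fromℚ p 0≤p
ι≅fromℚ 0≤p = upper⊆ (ι-upper 0≤p) , upper⊆ ι-upper⁻¹

ι-⊑ : ∀ {x p} → 0ℚ ≤ p → lower x p → ι p ⊑ x
ι-⊑ {x} 0≤p l = ≤ᴿ⇒⊑ λ q q<p → lower-down x (ι-lower⁻¹ 0≤p q<p) l

⊑-ι : ∀ {x p} → upper x p → x ⊑ ι p
⊑-ι {x} u = upper⊆ λ p<q → upper-up x (ι-upper⁻¹ p<q) u

opaque
  unfolding _⊕_ _⊗_

  ι-* : ∀ {a b} → 0ℚ ≤ a → 0ℚ ≤ b → ι a ⊗ ι b ≅ ι (a * b)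
  ι-* {a} {b} 0≤a 0≤b = ≤ᴿ⇒⊑ to , upper⊆ from
    where
    to : ι a ⊗ ι b ≤ᴿ ι (a * b)
    to q (inj₁ q<0) = lower-negative (ι (a * b)) q<0
    to q (inj₂ (x , y , 0≤x , 0≤y , x<a , y<b , q<xy)) =
      ι-lower (<-≤-trans q<xy (*-mono-≤⁺ 0≤y 0≤a (<⇒≤ (ι-lower⁻¹ 0≤a x<a)) (<⇒≤ (ι-lower⁻¹ 0≤b y<b))))
    from : ∀ {q} → upper (ι a ⊗ ι b) q → upper (ι (a * b)) q
    from (u , v , a<u , b<v , uv<q) = let a<u = ι-upper⁻¹ a<u in
      ι-upper (*-nonneg 0≤a 0≤b) (≤-<-trans (*-mono-≤⁺ 0≤b (≤-trans 0≤a (<⇒≤ a<u)) (<⇒≤ a<u) (<⇒≤ (ι-upper⁻¹ b<v))) uv<q)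

  ι-+ : ∀ {a b} → 0ℚ ≤ a → 0ℚ ≤ b → ι a ⊕ ι b ≅ ι (a + b)
  ι-+ {a} {b} 0≤a 0≤b =
    ≤ᴿ⇒⊑ (λ q (x , y , x<a , y<b , q<x+y) → ι-lower (<-trans q<x+y (+-mono-< (ι-lower⁻¹ 0≤a x<a) (ι-lower⁻¹ 0≤b y<b)))) ,
    upper⊆ λ (u , v , a<u , b<v , u+v<q) →
      ι-upper (+-mono-≤ 0≤a 0≤b) (<-trans (+-mono-< (ι-upper⁻¹ a<u) (ι-upper⁻¹ b<v)) u+v<q)

opaque
  unfolding _⊗_

  -- Locatedness yields exact bounds without dividing by c.
  lower-scale : ∀ {c} (0<c : 0ℚ < c) x {l} → lower x l → lower (ι c ⊗ x) (c * l)
  lower-scale {c} 0<c x {l} lx with lower-open x lx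
  ... | l′ , l<l′ , lx′ with located (ι c ⊗ x) (*-monoʳ-<-pos c {{positive 0<c}} l<l′)
  ... | inj₁ p = p
  ... | inj₂ (a , u , c<a , ux , au<cl′) = contradiction au<cl′ (<-asym (begin-strict
        c * l′ <⟨ *-monoʳ-<-pos c {{positive 0<c}} (lower<upper x lx′ ux) ⟩
        c * u  <⟨ *-monoˡ-<-pos u {{positive (upper-pos x ux)}} (ι-upper⁻¹ c<a) ⟩
        a * u  ∎))
    where open ≤-Reasoning

  upper-scale : ∀ {c} (0<c : 0ℚ < c) x {u} → upper x u → upper (ι c ⊗ x) (c * u)
  upper-scale {c} 0<c x {u} ux with upper-open x ux
  ... | u′ , u′<u , ux′ with located (ι c ⊗ x) (*-monoʳ-<-pos c {{positive 0<c}} u′<u)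
  ... | inj₂ p = p
  ... | inj₁ (inj₁ cu′<0) = contradiction (*-pos 0<c (upper-pos x ux′)) (<-asym cu′<0)
  ... | inj₁ (inj₂ (a , l , 0≤a , 0≤l , a<c , lx , cu′<al)) = contradiction cu′<al (<-asym (begin-strict
        a * l  ≤⟨ *-monoʳ-≤-nonNeg l {{nonNegative 0≤l}} (<⇒≤ (ι-lower⁻¹ (<⇒≤ 0<c) a<c)) ⟩
        c * l  <⟨ *-monoʳ-<-pos c {{positive 0<c}} (lower<upper x lx ux′) ⟩
        c * u′ ∎))
    where open ≤-Reasoning

1ᴿ : ℝ⁺
1ᴿ = ι 1ℚ

⊗-identityˡ : ∀ x → 1ᴿ ⊗ x ≅ x
⊗-identityˡ x = upper⊆ (λ {q} u → subst (upper (1ᴿ ⊗ x)) (*-identityˡ q) (upper-scale 0<1 x u)) , 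
  ≤ᴿ⇒⊑ λ q l → subst (lower (1ᴿ ⊗ x)) (*-identityˡ q) (lower-scale 0<1 x l)

⊗-identityʳ : ∀ x → x ⊗ 1ᴿ ≅ x
⊗-identityʳ x = ≅-trans (⊗-comm x 1ᴿ) (⊗-identityˡ x)

-- Reciprocals

abstract
  reciprocal : ∀ {p} → 0ℚ < p → ℚ
  reciprocal {p} 0<p = (1/ p) {{pos⇒nonZero p {{positive 0<p}}}}

  reciprocal-inverse : ∀ {p} (0<p : 0ℚ < p) → reciprocal 0<p * p ≡ 1ℚ
  reciprocal-inverse {p} 0<p = *-inverseˡ p {{pos⇒nonZero p {{positive 0<p}}}}

  reciprocal-pos : ∀ {p} (0<p : 0ℚ < p) → 0ℚ < reciprocal 0<p
  reciprocal-pos {p} 0<p = positive⁻¹ _ {{1/pos⇒pos p {{positive 0<p}}}}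

<reciprocal : ∀ {p q} (0<p : 0ℚ < p) → q * p < 1ℚ → q < reciprocal 0<p
<reciprocal {p} 0<p qp<1 = *-cancelʳ-<-nonNeg p {{nonNegative (<⇒≤ 0<p)}}
  (subst (_ <_) (sym (reciprocal-inverse 0<p)) qp<1)

reciprocal< : ∀ {p q} (0<p : 0ℚ < p) → 1ℚ < q * p → reciprocal 0<p < q
reciprocal< {p} 0<p 1<qp = *-cancelʳ-<-nonNeg p {{nonNegative (<⇒≤ 0<p)}}
  (subst (_< _) (sym (reciprocal-inverse 0<p)) 1<qp)

<reciprocal⁻¹ : ∀ {p q} (0<p : 0ℚ < p) → q < reciprocal 0<p → q * p < 1ℚ
<reciprocal⁻¹ {p} {q} 0<p q< = subst (q * p <_) (reciprocal-inverse 0<p) (*-monoˡ-<-pos p {{positive 0<p}} q<)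

reciprocal<⁻¹ : ∀ {p q} (0<p : 0ℚ < p) → reciprocal 0<p < q → 1ℚ < q * p
reciprocal<⁻¹ {p} {q} 0<p <q = subst (_< q * p) (reciprocal-inverse 0<p) (*-monoˡ-<-pos p {{positive 0<p}} <q)

opaque
  -- The cuts avoid division: `q` is below 1/x if `q * u < 1` for an upper bound `u`, which includes
  -- all `q ≤ 0`. The given positive lower bound of `x` inhabits the upper cut.
  inv : (x : ℝ⁺) → (∃[ l ] 0ℚ < l × lower x l) → ℝ⁺
  inv x (l₀ , 0<l₀ , lx₀) = record
    { lower           = Lo
    ; upper           = Up
    ; lower-negative  = λ q<0 → below1 (<⇒≤ q<0)
    ; upper-inhabited = reciprocal 0<l₀ + 1ℚ , l₀ , 0<l₀ , lx₀ , reciprocal<⁻¹ 0<l₀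
        (subst (_< reciprocal 0<l₀ + 1ℚ) (+-identityʳ (reciprocal 0<l₀)) (+-monoʳ-< (reciprocal 0<l₀) 0<1))
    ; lower-down      = λ { q<r (u , ux , ru<1) → u , ux ,
        <-trans (*-monoˡ-<-pos u {{positive (upper-pos x ux)}} q<r) ru<1 }
    ; upper-up        = λ { q<r (l , 0<l , lx , 1<ql) → l , 0<l , lx ,
        <-trans 1<ql (*-monoˡ-<-pos l {{positive 0<l}} q<r) }
    ; lower-open      = λ { (u , ux , qu<1) → let
        0<u = upper-pos x ux
        m , q<m , m<1/u = <-dense (<reciprocal {u} 0<u qu<1)
        in m , q<m , u , ux , <reciprocal⁻¹ 0<u m<1/u }
    ; upper-open      = λ { (l , 0<l , lx , 1<rl) → let
        m , 1/l<m , m<r = <-dense (reciprocal< {l} 0<l 1<rl)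
        in m , m<r , l , 0<l , lx , reciprocal<⁻¹ 0<l 1/l<m }
    ; disjoint        = λ { {q} (u , ux , qu<1) (l , 0<l , lx , 1<ql) → <-asym (lower<upper x lx ux)
        (*-cancelˡ-<-nonNeg q {{nonNegative (<⇒≤ (factor-pos {q} 0<l 1<ql))}} (<-trans qu<1 1<ql)) }
    ; located         = loc
    }
    where
    Lo Up : ℚ → Set
    Lo q = ∃[ u ] upper x u × q * u < 1ℚ
    Up q = ∃[ l ] 0ℚ < l × lower x l × 1ℚ < q * l
    below1 : ∀ {q} → q ≤ 0ℚ → Lo q
    below1 {q} q≤0 = let u , ux = upper-inhabited x in u , ux , ≤-<-trans
      (subst (q * u ≤_) (*-zeroˡ u) (*-monoʳ-≤-nonNeg u {{nonNegative (<⇒≤ (upper-pos x ux))}} q≤0)) 0<1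
    factor-pos : ∀ {q l} → 0ℚ < l → 1ℚ < q * l → 0ℚ < q
    factor-pos {q} {l} 0<l 1<ql = *-cancelʳ-<-nonNeg l {{nonNegative (<⇒≤ 0<l)}} (subst (_< q * l) (sym (*-zeroˡ l)) (<-trans 0<1 1<ql))
    loc : ∀ {q r} → q < r → Lo q ⊎ Up r
    loc {q} {r} q<r with 0ℚ <? q
    ... | no q≯0 = inj₁ (below1 (≮⇒≥ q≯0))
    ... | yes 0<q with located x {reciprocal 0<r} {reciprocal 0<q} 1/r<1/q
      where
      0<r : 0ℚ < r
      0<r = <-trans 0<q q<r
      1/r<1/q : reciprocal 0<r < reciprocal 0<q
      1/r<1/q = reciprocal< 0<r (subst (_< reciprocal 0<q * r) (reciprocal-inverse 0<q)
        (*-monoʳ-<-pos (reciprocal 0<q) {{positive (reciprocal-pos 0<q)}} q<r))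
    ... | inj₁ l = let
          m , 1/r<m , lx = lower-open x l
          in inj₂ (m , <-trans (reciprocal-pos _) 1/r<m , lx , subst (1ℚ <_) (*-comm m r) (reciprocal<⁻¹ {r} _ 1/r<m))
    ... | inj₂ u = let
          m , m<1/q , ux = upper-open x u
          in inj₁ (m , ux , subst (_< 1ℚ) (*-comm m q) (<reciprocal⁻¹ {q} _ m<1/q))

opaque
  unfolding _⊗_ inv

  inv-inverse : ∀ x pos → x ⊗ inv x pos ≅ 1ᴿ
  inv-inverse x pos = ≤ᴿ⇒⊑ to , upper⊆ from
    where
    open ≤-Reasoning
    to : x ⊗ inv x pos ≤ᴿ 1ᴿ
    to q (inj₁ q<0) = ι-lower (<-trans q<0 0<1)
    to q (inj₂ (a , b , 0≤a , 0≤b , la , (u , ux , bu<1) , q<ab)) = ι-lower (begin-strict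
      q     <⟨ q<ab ⟩
      a * b ≤⟨ *-monoʳ-≤-nonNeg b {{nonNegative 0≤b}} (<⇒≤ (lower<upper x la ux)) ⟩
      u * b ≡⟨ *-comm u b ⟩
      b * u <⟨ bu<1 ⟩
      1ℚ    ∎)
    from : ∀ {q} → upper (x ⊗ inv x pos) q → upper 1ᴿ q
    from {q} (u , v , ux , uv@(l , 0<l , lx , 1<vl) , uv<q) = ι-upper 0≤1 (begin-strict
      1ℚ    <⟨ 1<vl ⟩
      v * l <⟨ *-monoʳ-<-pos v {{positive (upper-pos (inv x pos) {v} uv)}} (lower<upper x lx ux) ⟩
      v * u ≡⟨ *-comm v u ⟩
      u * v <⟨ uv<q ⟩
      q     ∎)

-- Powers of two

≤⇒≯ : ∀ {p q} → p ≤ q → ¬ q < p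
≤⇒≯ p≤q q<p = <-irrefl refl (<-≤-trans q<p p≤q)

toℚᵘ-/ : ∀ i b → toℚᵘ (i / suc b) ℚᵘ.≃ ℚᵘ.mkℚᵘ i b
toℚᵘ-/ i b = toℚᵘ-fromℚᵘ (ℚᵘ.mkℚᵘ i b)

/-+-/ : ∀ i j a b → i / suc a + j / suc b ≡ (i ℤ.* + suc b ℤ.+ j ℤ.* + suc a) / suc (b ℕ.+ a ℕ.* suc b)
/-+-/ i j a b = toℚᵘ-injective
  (ℚᵘₚ.≃-trans (toℚᵘ-homo-+ (i / suc a) (j / suc b))
    (ℚᵘₚ.≃-trans (ℚᵘₚ.+-cong (toℚᵘ-/ i a) (toℚᵘ-/ j b)) (ℚᵘₚ.≃-sym (toℚᵘ-/ _ (b ℕ.+ a ℕ.* suc b)))))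

/-*-/ : ∀ i j a b → i / suc a * (j / suc b) ≡ (i ℤ.* j) / suc (b ℕ.+ a ℕ.* suc b)
/-*-/ i j a b = toℚᵘ-injective
  (ℚᵘₚ.≃-trans (toℚᵘ-homo-* (i / suc a) (j / suc b))
    (ℚᵘₚ.≃-trans (ℚᵘₚ.*-cong (toℚᵘ-/ i a) (toℚᵘ-/ j b)) (ℚᵘₚ.≃-sym (toℚᵘ-/ _ (b ℕ.+ a ℕ.* suc b)))))

frac-sum : ∀ a a′ b b′ → + a / suc b + + a′ / suc b′ ≡ + (a ℕ.* suc b′ ℕ.+ a′ ℕ.* suc b) / suc (b′ ℕ.+ b ℕ.* suc b′)
frac-sum a a′ b b′ = trans (/-+-/ (+ a) (+ a′) b b′)
  (cong (_/ suc (b′ ℕ.+ b ℕ.* suc b′)) (cong₂ ℤ._+_ (sym (ℤₚ.pos-* a (suc b′))) (sym (ℤₚ.pos-* a′ (suc b)))))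

opaque
  unfolding 2⁻_

  2⁻-mono : ∀ {x y} → x ⊑ y → 2⁻ y ⊑ 2⁻ x
  2⁻-mono {x} {y} x⊑y = ≤ᴿ⇒⊑ λ q (t , a , b , q<t , 0≤t , u , h) → t , a , b , q<t , 0≤t , upper-⊆ x⊑y u , h

2⁻-cong : ∀ {x y} → x ≅ y → 2⁻ x ≅ 2⁻ y
2⁻-cong (p , q) = 2⁻-mono q , 2⁻-mono p

module _ (t t′ : ℚ) (a a′ B B′ : ℕ) where

  -- Puts the exponents `a`/`B` and `a′`/`B′` over the common denominator `B * B′`, so that bounds
  -- on two powers of two combine to a bound on their product.
  power-sum : (t * t′) ^ (B ℕ.* B′) * 2ℚ ^ (a ℕ.* B′ ℕ.+ a′ ℕ.* B)
            ≡ (t ^ B * 2ℚ ^ a) ^ B′ * (t′ ^ B′ * 2ℚ ^ a′) ^ B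
  power-sum = begin
    (t * t′) ^ (B ℕ.* B′) * 2ℚ ^ (a ℕ.* B′ ℕ.+ a′ ℕ.* B)
      ≡⟨ cong₂ _*_ (^-distrib-* t t′ (B ℕ.* B′)) (^-homo-* 2ℚ (a ℕ.* B′) (a′ ℕ.* B)) ⟩
    t ^ (B ℕ.* B′) * t′ ^ (B ℕ.* B′) * (2ℚ ^ (a ℕ.* B′) * 2ℚ ^ (a′ ℕ.* B))
      ≡⟨ cong (λ n → t ^ (B ℕ.* B′) * t′ ^ n * (2ℚ ^ (a ℕ.* B′) * 2ℚ ^ (a′ ℕ.* B))) (ℕₚ.*-comm B B′) ⟩
    t ^ (B ℕ.* B′) * t′ ^ (B′ ℕ.* B) * (2ℚ ^ (a ℕ.* B′) * 2ℚ ^ (a′ ℕ.* B))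
      ≡⟨ solve 4 (λ x y z w → x :* y :* (z :* w) := x :* z :* (y :* w)) refl
           (t ^ (B ℕ.* B′)) (t′ ^ (B′ ℕ.* B)) (2ℚ ^ (a ℕ.* B′)) (2ℚ ^ (a′ ℕ.* B)) ⟩
    t ^ (B ℕ.* B′) * 2ℚ ^ (a ℕ.* B′) * (t′ ^ (B′ ℕ.* B) * 2ℚ ^ (a′ ℕ.* B))
      ≡⟨ sym (cong₂ _*_ (power-product t B a B′) (power-product t′ B′ a′ B)) ⟩
    (t ^ B * 2ℚ ^ a) ^ B′ * (t′ ^ B′ * 2ℚ ^ a′) ^ B ∎
    where
    open ≡-Reasoning
    open +-*-Solver
    power-product : ∀ t B a C → (t ^ B * 2ℚ ^ a) ^ C ≡ t ^ (B ℕ.* C) * 2ℚ ^ (a ℕ.* C)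
    power-product t B a C = trans (^-distrib-* (t ^ B) (2ℚ ^ a) C) (cong₂ _*_ (^-assocʳ t B C) (^-assocʳ 2ℚ a C))

^-≤1 : ∀ {q} n → 0ℚ ≤ q → q ≤ 1ℚ → q ^ n ≤ 1ℚ
^-≤1 {q} n 0≤q q≤1 = subst (q ^ n ≤_) (1^ n) (^-mono n 0≤q q≤1)

1≤^ : ∀ {q} n → 1ℚ ≤ q → 1ℚ ≤ q ^ n
1≤^ {q} n 1≤q = subst (_≤ q ^ n) (1^ n) (^-mono n 0≤1 1≤q)

opaque
  unfolding _⊕_ _⊗_ 2⁻_

  2⁻-⊕ : ∀ x y → 2⁻ (x ⊕ y) ≅ 2⁻ x ⊗ 2⁻ y
  2⁻-⊕ x y = upper⊆ to , ≤ᴿ⇒⊑ from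
    where
    open ≤-Reasoning
    2^-nonneg : ∀ n → 0ℚ ≤ 2ℚ ^ n
    2^-nonneg n = <⇒≤ (2^-pos n)
    to : ∀ {q} → upper (2⁻ x ⊗ 2⁻ y) q → upper (2⁻ (x ⊕ y)) q
    to {q} (u , v , inj₁ 1<u , inj₁ 1<v , uv<q) = inj₁ (<-trans (begin-strict
      1ℚ      <⟨ 1<u ⟩
      u       ≡⟨ sym (*-identityʳ u) ⟩
      u * 1ℚ  <⟨ *-monoʳ-<-pos u {{positive (<-trans 0<1 1<u)}} 1<v ⟩
      u * v   ∎) uv<q)
    -- A bound above 1 carries no exponent. The exponent of the other factor is kept: it lies below
    -- one summand, hence below the sum.
    to {q} (u , v , inj₁ 1<u , inj₂ (t , a , b , t<v , 0<t , l , h) , uv<q) =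
      inj₂ (t , a , b , (begin-strict
        t       <⟨ t<v ⟩
        v       ≡⟨ sym (*-identityˡ v) ⟩
        1ℚ * v  <⟨ *-monoˡ-<-pos v {{positive (<-trans 0<t t<v)}} 1<u ⟩
        u * v   <⟨ uv<q ⟩
        q       ∎) , 0<t , lower-⊆ (y⊑x+y x y) l , h)
    to {q} (u , v , inj₂ (t , a , b , t<u , 0<t , l , h) , inj₁ 1<v , uv<q) =
      inj₂ (t , a , b , (begin-strict
        t       <⟨ t<u ⟩
        u       ≡⟨ sym (*-identityʳ u) ⟩
        u * 1ℚ  <⟨ *-monoʳ-<-pos u {{positive (<-trans 0<t t<u)}} 1<v ⟩
        u * v   <⟨ uv<q ⟩
        q       ∎) , 0<t , lower-⊆ (x⊑x+y x y) l , h)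
    to {q} (u , v , inj₂ (t , a , b , t<u , 0<t , l , h) , inj₂ (t′ , a′ , b′ , t′<v , 0<t′ , l′ , h′) , uv<q)
      -- The cut of a sum is strict, so the sum of the two fractions must lie strictly below a sum
      -- of lower bounds; hence the passage from `a / suc b` to `m`.
      with lower-open x l
    ... | m , a/b<m , lm =
      inj₂ (t * t′ , a ℕ.* suc b′ ℕ.+ a′ ℕ.* suc b , b′ ℕ.+ b ℕ.* suc b′ ,
        <-trans (*-mono-<⁺ 0<t′ (<⇒≤ (<-trans 0<t t<u)) t<u (<⇒≤ t′<v)) uv<q ,
        *-pos 0<t 0<t′ ,
        (m , + a′ / suc b′ , lm , l′ , subst (_< m + + a′ / suc b′) (frac-sum a a′ b b′) (+-monoˡ-< (+ a′ / suc b′) a/b<m)) ,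
        (begin
          1ℚ * 1ℚ
            ≤⟨ *-mono-≤⁺ 0≤1 (≤-trans 0≤1 (1≤^ (suc b′) h)) (1≤^ (suc b′) h) (1≤^ (suc b) h′) ⟩
          (t ^ suc b * 2ℚ ^ a) ^ suc b′ * (t′ ^ suc b′ * 2ℚ ^ a′) ^ suc b
            ≡⟨ sym (power-sum t t′ a a′ (suc b) (suc b′)) ⟩
          (t * t′) ^ (suc b ℕ.* suc b′) * 2ℚ ^ (a ℕ.* suc b′ ℕ.+ a′ ℕ.* suc b) ∎))
    from : 2⁻ x ⊗ 2⁻ y ≤ᴿ 2⁻ (x ⊕ y)
    from q (inj₁ q<0) = lower-negative (2⁻ (x ⊕ y)) q<0
    from q (inj₂ (c , d , 0≤c , 0≤d , (t , a , b , c<t , 0≤t , u , h) , (t′ , a′ , b′ , d<t′ , 0≤t′ , u′ , h′) , q<cd))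
      with upper-open x u
    ... | m , m<a/b , um =
      t * t′ , a ℕ.* suc b′ ℕ.+ a′ ℕ.* suc b , b′ ℕ.+ b ℕ.* suc b′ ,
      <-≤-trans q<cd (*-mono-≤⁺ 0≤d 0≤t (<⇒≤ c<t) (<⇒≤ d<t′)) ,
      *-nonneg 0≤t 0≤t′ ,
      (m , + a′ / suc b′ , um , u′ , subst (m + + a′ / suc b′ <_) (frac-sum a a′ b b′) (+-monoˡ-< (+ a′ / suc b′) m<a/b)) ,
      (begin
          (t * t′) ^ (suc b ℕ.* suc b′) * 2ℚ ^ (a ℕ.* suc b′ ℕ.+ a′ ℕ.* suc b)
            ≡⟨ power-sum t t′ a a′ (suc b) (suc b′) ⟩
          (t ^ suc b * 2ℚ ^ a) ^ suc b′ * (t′ ^ suc b′ * 2ℚ ^ a′) ^ suc b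
            ≤⟨ *-mono-≤⁺ (^-nonneg (suc b) 0≤t′2^a′) 0≤1 (^-≤1 (suc b′) 0≤t2^a h) (^-≤1 (suc b) 0≤t′2^a′ h′) ⟩
          1ℚ * 1ℚ ∎)
      where
      0≤t2^a : 0ℚ ≤ t ^ suc b * 2ℚ ^ a
      0≤t2^a = *-nonneg (^-nonneg (suc b) 0≤t) (2^-nonneg a)
      0≤t′2^a′ : 0ℚ ≤ t′ ^ suc b′ * 2ℚ ^ a′
      0≤t′2^a′ = *-nonneg (^-nonneg (suc b′) 0≤t′) (2^-nonneg a′)

0≤n/d : ∀ n b → 0ℚ ≤ + n / suc b
0≤n/d n b = nonNegative⁻¹ (+ n / suc b) {{normalize-nonNeg n (suc b)}}

opaque
  unfolding ν

  ι≅ν : ∀ n → ι (+ n / 1) ≅ ν n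
  ι≅ν n = ι≅fromℚ (nonNegative⁻¹ (+ n / 1) {{normalize-nonNeg n 1}})

opaque
  unfolding _⊗_ 2⁻_ ν

  ⊗-zeroˡ : ∀ x y → ν 0 ⊗ x ⊑ y
  ⊗-zeroˡ x y = ≤ᴿ⇒⊑ λ
    { q (inj₁ q<0) → lower-negative y q<0
    ; q (inj₂ (a , b , 0≤a , _ , a<0 , _)) → contradiction a<0 (≤⇒≯ 0≤a) }

  -- No fraction `a / suc b` lies below 0, so of the upper cut of `2⁻ x` only the clause for bounds
  -- above 1 survives.
  2⁻-0 : ∀ {x} → x ⊑ ν 0 → 2⁻ x ≅ 1ᴿ
  2⁻-0 {x} x⊑0 = upper⊆ (λ u → inj₁ (ι-upper⁻¹ u)) , upper⊆ λ
    { (inj₁ 1<q) → ι-upper 0≤1 1<q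
    ; (inj₂ (t , a , b , _ , _ , l , _)) → contradiction (lower-⊆ x⊑0 l) (≤⇒≯ (0≤n/d a b)) }

  2⁻-lower-pos : ∀ x → ∃[ l ] 0ℚ < l × lower (2⁻ x) l
  2⁻-lower-pos x with upper-inhabited x
  ... | u , ux with archimedean u 0
  -- `t` is 2^(-(k+1)), where k + 1 exceeds `x`; it is halved because lower cuts are open.
  ... | k , u<k = ½ * t , 0<½t , t , suc k , 0 , ½t<t , <⇒≤ 0<t , upper-up x u<k ux , ≤-reflexive (begin
      t * 1ℚ * 2ℚ ^ suc k ≡⟨ cong (_* 2ℚ ^ suc k) (*-identityʳ t) ⟩
      t * 2ℚ ^ suc k      ≡⟨ sym (^-distrib-* ½ 2ℚ (suc k)) ⟩
      1ℚ ^ suc k          ≡⟨ 1^ (suc k) ⟩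
      1ℚ                  ∎)
    where
    open ≡-Reasoning
    t : ℚ
    t = ½ ^ suc k
    0<t : 0ℚ < t
    0<t = ^-pos (suc k) (positive⁻¹ ½)
    0<½t : 0ℚ < ½ * t
    0<½t = *-pos (positive⁻¹ ½) 0<t
    ½<1 : ½ < 1ℚ
    ½<1 = +-monoʳ-< ½ {0ℚ} {½} (positive⁻¹ ½)
    ½t<t : ½ * t < t
    ½t<t = subst (½ * t <_) (*-identityˡ t) (*-monoˡ-<-pos t {{positive 0<t}} ½<1)

infixr 9 _^ᴿ_

_^ᴿ_ : ℝ⁺ → ℕ → ℝ⁺
x ^ᴿ zero  = 1ᴿ
x ^ᴿ suc n = x ⊗ x ^ᴿ n

^ᴿ-mono : ∀ {x y} n → x ⊑ y → x ^ᴿ n ⊑ y ^ᴿ n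
^ᴿ-mono zero    _   = ⊑-refl
^ᴿ-mono (suc n) x⊑y = ⊗-mono x⊑y (^ᴿ-mono n x⊑y)

ι-^ : ∀ {p} → 0ℚ ≤ p → ∀ n → ι p ^ᴿ n ≅ ι (p ^ n)
ι-^ 0≤p zero        = ≅-refl
ι-^ {p} 0≤p (suc n) = ≅-trans (⊗-cong ≅-refl (ι-^ 0≤p n)) (ι-* {p} {p ^ n} 0≤p (^-nonneg n 0≤p))

ν-suc : ∀ n → 1ᴿ ⊕ ν n ≅ ν (suc n)
ν-suc n = begin-equality
  1ᴿ ⊕ ν n       ≈⟨ ⊕-cong ≅-refl (swap (ι≅ν n)) ⟩
  1ᴿ ⊕ ι (+ n / 1)   ≈⟨ ι-+ 0≤1 (0≤n/d n 0) ⟩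
  ι (1ℚ + + n / 1)    ≡⟨ cong ι (frac-+ 1 n 0) ⟩
  ι (+ suc n / 1)     ≈⟨ ι≅ν (suc n) ⟩
  ν (suc n)       ∎
  where open ⊑-Reasoning

2⁻-⊗-zero : ∀ s → 2⁻ (s ⊗ ν 0) ≅ 1ᴿ
2⁻-⊗-zero s = 2⁻-0 (⊑-trans (proj₁ (⊗-comm s (ν 0))) (⊗-zeroˡ s (ν 0)))

2⁻-⊗-suc : ∀ s n → 2⁻ (s ⊗ ν (suc n)) ≅ 2⁻ s ⊗ 2⁻ (s ⊗ ν n)
2⁻-⊗-suc s n = begin-equality
  2⁻ (s ⊗ ν (suc n))         ≈⟨ 2⁻-cong (⊗-cong ≅-refl (swap (ν-suc n))) ⟩
  2⁻ (s ⊗ (1ᴿ ⊕ ν n))        ≈⟨ 2⁻-cong (⊗-distribˡ s 1ᴿ (ν n)) ⟩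
  2⁻ (s ⊗ 1ᴿ ⊕ s ⊗ ν n)      ≈⟨ 2⁻-⊕ (s ⊗ 1ᴿ) (s ⊗ ν n) ⟩
  2⁻ (s ⊗ 1ᴿ) ⊗ 2⁻ (s ⊗ ν n) ≈⟨ ⊗-cong (2⁻-cong (⊗-identityʳ s)) ≅-refl ⟩
  2⁻ s ⊗ 2⁻ (s ⊗ ν n)        ∎
  where open ⊑-Reasoning

2⁻-⊗ : ∀ s n → 2⁻ (s ⊗ ν n) ≅ (2⁻ s) ^ᴿ n
2⁻-⊗ s zero    = 2⁻-⊗-zero s
2⁻-⊗ s (suc n) = ≅-trans (2⁻-⊗-suc s n) (⊗-cong ≅-refl (2⁻-⊗ s n))

-- Rational bounds for powers of two

bernoulli-≥ : ∀ {x} → 0ℚ ≤ x → x ≤ 1ℚ → ∀ n → 1ℚ - + n / 1 * x ≤ (1ℚ - x) ^ n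
bernoulli-≥ {x} 0≤x x≤1 zero = ≤-reflexive (solve 1 (λ x → con 1ℚ :- con 0ℚ :* x := con 1ℚ) refl x)
  where open +-*-Solver
bernoulli-≥ {x} 0≤x x≤1 (suc n) = begin
  1ℚ - + suc n / 1 * x             ≡⟨ cong (λ z → 1ℚ - z * x) (sym (frac-+ 1 n 0)) ⟩
  1ℚ - (1ℚ + N) * x                ≡⟨ sym (+-identityʳ _) ⟩
  1ℚ - (1ℚ + N) * x + 0ℚ           ≤⟨ +-monoʳ-≤ (1ℚ - (1ℚ + N) * x) (*-nonneg (0≤n/d n 0) (*-nonneg 0≤x 0≤x)) ⟩
  1ℚ - (1ℚ + N) * x + N * (x * x)  ≡⟨ solve 2 (λ N x → con 1ℚ :- (con 1ℚ :+ N) :* x :+ N :* (x :* x)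
                                        := (con 1ℚ :- x) :* (con 1ℚ :- N :* x)) refl N x ⟩
  (1ℚ - x) * (1ℚ - N * x)          ≤⟨ *-monoˡ-≤-nonNeg (1ℚ - x) {{nonNegative 0≤1-x}} (bernoulli-≥ 0≤x x≤1 n) ⟩
  (1ℚ - x) * (1ℚ - x) ^ n          ∎
  where
  open ≤-Reasoning
  open +-*-Solver
  N = + n / 1
  0≤1-x : 0ℚ ≤ 1ℚ - x
  0≤1-x = subst (_≤ 1ℚ - x) (+-inverseʳ x) (+-monoˡ-≤ (- x) x≤1)

opaque
  unfolding 2⁻_

  ι-⊑2⁻ : ∀ {x t a b} → 0ℚ ≤ t → upper x (+ a / suc b) → t ^ suc b * 2ℚ ^ a ≤ 1ℚ → ι t ⊑ 2⁻ x
  ι-⊑2⁻ {t = t} {a} {b} 0≤t u h = ≤ᴿ⇒⊑ λ p p<t → t , a , b , ι-lower⁻¹ 0≤t p<t , 0≤t , u , h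

  2⁻⊑ι : ∀ {x t a b} → 0ℚ < t → lower x (+ a / suc b) → 1ℚ ≤ t ^ suc b * 2ℚ ^ a → 2⁻ x ⊑ ι t
  2⁻⊑ι {t = t} {a} {b} 0<t l h = upper⊆ λ t<q → inj₂ (t , a , b , ι-upper⁻¹ t<q , 0<t , l , h)

-- `growth` from φ to 1 yields an exponent with 4φ^(b+1) ≤ 1, so a multiple of it brings the product
-- down to 1; from there one descends to the first such exponent. At exponent 0 the product is
-- 2^(a+1) > 1, so the first one has a predecessor.
crossing : ∀ {φ} → 0ℚ < φ → φ < 1ℚ → ∀ a →
           ∃[ k ] φ ^ suc k * 2ℚ ^ suc a ≤ 1ℚ × 1ℚ < φ ^ k * 2ℚ ^ suc a
crossing {φ} 0<φ φ<1 a with growth 0<φ φ<1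
... | b , 4φ^b≤1^b = descend (suc b ℕ.* suc a) small
  where
  open ≤-Reasoning
  open +-*-Solver
  y = φ ^ suc b
  0≤y : 0ℚ ≤ y
  0≤y = <⇒≤ (^-pos (suc b) 0<φ)
  y2≤1 : y * 2ℚ ≤ 1ℚ
  y2≤1 = begin
    y * 2ℚ     ≤⟨ *-monoˡ-≤-nonNeg y {{nonNegative 0≤y}} (≤ᵇ⇒≤ _) ⟩
    y * 4ℚ     ≡⟨ *-comm y 4ℚ ⟩
    4ℚ * y     ≤⟨ 4φ^b≤1^b ⟩
    1ℚ ^ suc b ≡⟨ 1^ (suc b) ⟩
    1ℚ         ∎
  small : φ ^ (suc b ℕ.* suc a) * 2ℚ ^ suc a ≤ 1ℚ
  small = begin
    φ ^ (suc b ℕ.* suc a) * 2ℚ ^ suc a ≡⟨ cong (_* 2ℚ ^ suc a) (sym (^-assocʳ φ (suc b) (suc a))) ⟩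
    y ^ suc a * 2ℚ ^ suc a             ≡⟨ sym (^-distrib-* y 2ℚ (suc a)) ⟩
    (y * 2ℚ) ^ suc a                   ≤⟨ ^-≤1 (suc a) (*-nonneg 0≤y (<⇒≤ (2^-pos 1))) y2≤1 ⟩
    1ℚ                                 ∎
  descend : ∀ k → φ ^ k * 2ℚ ^ suc a ≤ 1ℚ →
            ∃[ k ] φ ^ suc k * 2ℚ ^ suc a ≤ 1ℚ × 1ℚ < φ ^ k * 2ℚ ^ suc a
  descend zero    h = contradiction (begin-strict
    1ℚ                 <⟨ 2^-mono-< {0} {suc a} (ℕ.s≤s ℕ.z≤n) ⟩
    2ℚ ^ suc a         ≡⟨ sym (*-identityˡ _) ⟩
    1ℚ * 2ℚ ^ suc a    ∎) (≤⇒≯ h)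
  descend (suc k) h with φ ^ k * 2ℚ ^ suc a ≤? 1ℚ
  ... | yes h′ = descend k h′
  ... | no  h′ = k , h , ≰⇒> h′

-- The mesh satisfies 2/(b+1) < (q - r)/2. Two steps are used up by the grid interval that contains
-- `r`; the two steps between the fractions are the ones that `2⁻-gap` consumes.
fraction-between : ∀ {r q} → 0ℚ < r → r < q → ∃₂ λ a b → r < + suc a / suc b × + (3 ℕ.+ a) / suc b < q
fraction-between {r} {q} 0<r r<q with small-frac (½ * (q - r)) (*-pos (positive⁻¹ ½) (p<q⇒0<q-p r<q))
... | b , 2/b<ε with grid (fromℚ r (<⇒≤ 0<r)) b
... | inj₁ r<1/b = 0 , b , r<1/b , (begin-strict
      + 3 / suc b                      ≡⟨ sym (frac-+ 1 2 b) ⟩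
      + 1 / suc b + + 2 / suc b        <⟨ +-mono-< (<-trans (frac-< {1} {b} {2} {b} (ℕₚ.*-monoˡ-< (suc b) (ℕₚ.n<1+n 1))) 2/b<ε) 2/b<ε ⟩
      ½ * (q - r) + ½ * (q - r)        ≡⟨ solve 1 (λ x → con ½ :* x :+ con ½ :* x := con 0ℚ :+ x) refl (q - r) ⟩
      0ℚ + (q - r)                     <⟨ +-monoˡ-< (q - r) 0<r ⟩
      r + (q - r)                      ≡⟨ solve 2 (λ q r → r :+ (q :- r) := q) refl q r ⟩
      q                                ∎)
  where
  open ≤-Reasoning
  open +-*-Solver
... | inj₂ (j , j/b<r , r<2+j/b) = suc j , b , r<2+j/b , (begin-strict
      + (4 ℕ.+ j) / suc b                     ≡⟨ sym (trans (cong (_+_ (+ 2 / suc b)) (frac-+ 2 j b)) (frac-+ 2 (2 ℕ.+ j) b)) ⟩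
      + 2 / suc b + (+ 2 / suc b + + j / suc b) <⟨ +-mono-< 2/b<ε (+-mono-< 2/b<ε j/b<r) ⟩
      ½ * (q - r) + (½ * (q - r) + r)        ≡⟨ solve 2 (λ q r → con ½ :* (q :- r) :+ (con ½ :* (q :- r) :+ r) := q) refl q r ⟩
      q                                       ∎)
  where
  open ≤-Reasoning
  open +-*-Solver

n/1*1/n≡1 : ∀ b → + suc b / 1 * (+ 1 / suc b) ≡ 1ℚ
n/1*1/n≡1 b = trans (/-*-/ (+ suc b) (+ 1) 0 b) (toℚᵘ-injective (ℚᵘₚ.≃-trans (toℚᵘ-/ (+ suc b ℤ.* + 1) (b ℕ.+ 0 ℕ.* suc b)) (ℚᵘ.*≡*
  (trans (ℤₚ.*-identityʳ _) (trans (ℤₚ.*-identityʳ _)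
    (trans (cong (λ m → + suc m) (sym (ℕₚ.+-identityʳ b))) (sym (ℤₚ.*-identityˡ _))))))))

1≤n/1 : ∀ b → 1ℚ ≤ + suc b / 1
1≤n/1 b = subst (1ℚ ≤_) (frac-+ 1 b 0) (subst (_≤ 1ℚ + + b / 1) (+-identityʳ 1ℚ) (+-monoʳ-≤ 1ℚ (0≤n/d b 0)))

-- The witness is θ = 1 - x: Bernoulli's inequality gives θ^(b+1) ≥ 1 - (b+1)x = ½.
subunit-root : ∀ b {x} → 0ℚ < x → + suc b / 1 * x ≡ ½ → ∃[ θ ] ½ ≤ θ × θ < 1ℚ × ½ ≤ θ ^ suc b
subunit-root b {x} 0<x bx≡½ = 1ℚ - x ,
    +-monoʳ-≤ 1ℚ (neg-antimono-≤ x≤½) ,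
    subst (1ℚ - x <_) (+-identityʳ 1ℚ) (+-monoʳ-< 1ℚ (neg-antimono-< 0<x)) ,
    subst (_≤ (1ℚ - x) ^ suc b) (cong (λ z → 1ℚ - z) bx≡½) (bernoulli-≥ (<⇒≤ 0<x) (≤-trans x≤½ (≤ᵇ⇒≤ _)) (suc b))
  where
  x≤½ : x ≤ ½
  x≤½ = subst (_≤ ½) (*-identityˡ x) (subst (1ℚ * x ≤_) bx≡½ (*-monoʳ-≤-nonNeg x {{nonNegative (<⇒≤ 0<x)}} (1≤n/1 b)))

abstract
  near-one : ∀ b → ∃[ θ ] ½ ≤ θ × θ < 1ℚ × ½ ≤ θ ^ suc b
  near-one b = subunit-root b {½ * (+ 1 / suc b)} (*-pos (positive⁻¹ ½) (frac-< {0} {0} {1} {b} (ℕ.s≤s ℕ.z≤n))) (begin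
    + suc b / 1 * (½ * (+ 1 / suc b)) ≡⟨ solve 3 (λ B h i → B :* (h :* i) := h :* (B :* i)) refl (+ suc b / 1) ½ (+ 1 / suc b) ⟩
    ½ * (+ suc b / 1 * (+ 1 / suc b)) ≡⟨ cong (½ *_) (n/1*1/n≡1 b) ⟩
    ½ * 1ℚ                            ≡⟨ *-identityʳ ½ ⟩
    ½                                 ∎)
    where
    open ≡-Reasoning
    open +-*-Solver

-- θ^B ≥ ½, so consecutive powers of θ differ at most by the factor 2^(−1/B);
-- ρ is the first of them below 2^(−a/B), where r < a/B and (a + 2)/B < q.
2⁻-gap : ∀ {r q} → 0ℚ < r → r < q →
  ∃₂ λ ρ θ → 0ℚ < ρ × 0ℚ < θ × θ < 1ℚ × ι ρ ⊑ 2⁻ ι r × 2⁻ ι q ⊑ ι (θ * ρ)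
2⁻-gap {r} {q} 0<r r<q with fraction-between 0<r r<q
... | a , b , r<a/b , a+2/b<q =
    ρ , θ , 0<ρ , 0<θ , θ<1 ,
    ι-⊑2⁻ {ι r} {ρ} {suc a} {b} (<⇒≤ 0<ρ) (ι-upper (<⇒≤ 0<r) r<a/b) (subst (λ z → z * 2ℚ ^ suc a ≤ 1ℚ) (sym (power-swap (suc k))) φ-small) ,
    2⁻⊑ι {ι q} {θ * ρ} {3 ℕ.+ a} {b} (*-pos 0<θ 0<ρ) (ι-lower a+2/b<q) (subst (λ z → 1ℚ ≤ z * 2ℚ ^ (3 ℕ.+ a)) (sym (power-swap (2 ℕ.+ k))) φ-large)
  where
  open ≤-Reasoning
  open +-*-Solver
  B = suc b
  θ φ : ℚ
  θ = proj₁ (near-one b)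
  φ = θ ^ B
  θ<1 = proj₁ (proj₂ (proj₂ (near-one b)))
  ½≤φ = proj₂ (proj₂ (proj₂ (near-one b)))
  0<θ : 0ℚ < θ
  0<θ = <-≤-trans (positive⁻¹ ½) (proj₁ (proj₂ (near-one b)))
  0<φ : 0ℚ < φ
  0<φ = ^-pos B 0<θ
  φ<1 : φ < 1ℚ
  φ<1 = ≤-<-trans (subst (φ ≤_) (*-identityʳ θ) (*-monoˡ-≤-nonNeg θ {{nonNegative (<⇒≤ 0<θ)}} (^-≤1 b (<⇒≤ 0<θ) (<⇒≤ θ<1)))) θ<1
  k = proj₁ (crossing 0<φ φ<1 a)
  φ-small = proj₁ (proj₂ (crossing 0<φ φ<1 a))
  ρ = θ ^ suc k
  0<ρ : 0ℚ < ρ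
  0<ρ = ^-pos (suc k) 0<θ
  power-swap : ∀ n → (θ ^ n) ^ B ≡ φ ^ n
  power-swap n = trans (^-assocʳ θ n B) (trans (cong (θ ^_) (ℕₚ.*-comm n B)) (sym (^-assocʳ θ B n)))
  1≤2φ : 1ℚ ≤ 2ℚ * φ
  1≤2φ = *-monoˡ-≤-nonNeg 2ℚ {{nonNegative (<⇒≤ (2^-pos 1))}} ½≤φ
  -- `θ * ρ` is two powers past `θ ^ k`, the last one above the bound. Each of them costs a factor φ
  -- ≥ ½ after taking the power `B`, which one further factor 2 repays.
  φ-large : 1ℚ ≤ φ ^ (2 ℕ.+ k) * 2ℚ ^ (3 ℕ.+ a)
  φ-large = begin
    1ℚ * (1ℚ * 1ℚ)
      ≤⟨ *-mono-≤⁺ 0≤1 (≤-trans 0≤1 1≤2φ) 1≤2φ (*-mono-≤⁺ 0≤1 (≤-trans 0≤1 1≤2φ) 1≤2φ (<⇒≤ (proj₂ (proj₂ (crossing 0<φ φ<1 a))))) ⟩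
    2ℚ * φ * (2ℚ * φ * (φ ^ k * 2ℚ ^ suc a))
      ≡⟨ solve 4 (λ t f x y → t :* f :* (t :* f :* (x :* y)) := f :* (f :* x) :* (t :* (t :* y))) refl 2ℚ φ (φ ^ k) (2ℚ ^ suc a) ⟩
    φ ^ (2 ℕ.+ k) * 2ℚ ^ (3 ℕ.+ a) ∎

-- Recursive functions

Recursive : ∀ {n} → (Vec ℕ n → ℕ) → Set
Recursive {n} F = Σ[ r ∈ Rec n ] (∀ xs → r [ xs ]⇓ F xs)

Recursive₁ : (ℕ → ℕ) → Set
Recursive₁ f = Σ[ r ∈ Rec 1 ] (∀ x → r [ x ∷ [] ]⇓ f x)

Recursive₂ : (ℕ → ℕ → ℕ) → Set
Recursive₂ f = Σ[ r ∈ Rec 2 ] (∀ x y → r [ x ∷ y ∷ [] ]⇓ f x y)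

module _ {n : ℕ} where

  var : (i : Fin n) → Recursive (λ xs → lookup xs i)
  var i = proj i , λ xs → proj⇓

  app₁ : ∀ {f} {G : Vec ℕ n → ℕ} → Recursive₁ f → Recursive G → Recursive (λ xs → f (G xs))
  app₁ (f , f⇓) (g , g⇓) = comp f (g ∷ []) , λ xs → comp⇓ (∷⇓ (g⇓ xs) []⇓) (f⇓ _)

  app₂ : ∀ {f} {G H : Vec ℕ n → ℕ} → Recursive₂ f → Recursive G → Recursive H → Recursive (λ xs → f (G xs) (H xs))
  app₂ (f , f⇓) (g , g⇓) (h , h⇓) = comp f (g ∷ h ∷ []) , λ xs → comp⇓ (∷⇓ (g⇓ xs) (∷⇓ (h⇓ xs) []⇓)) (f⇓ _ _)

  suc-recursive : ∀ {G : Vec ℕ n → ℕ} → Recursive G → Recursive (λ xs → suc (G xs))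
  suc-recursive (g , g⇓) = comp succ (g ∷ []) , λ xs → comp⇓ (∷⇓ (g⇓ xs) []⇓) succ⇓

  const-recursive : ∀ k → Recursive {n} (λ _ → k)
  const-recursive zero    = zero , λ xs → zero⇓
  const-recursive (suc k) = suc-recursive (const-recursive k)

unary : ∀ {F} → Recursive {1} F → Recursive₁ (λ x → F (x ∷ []))
unary (r , r⇓) = r , λ x → r⇓ (x ∷ [])

binary : ∀ {F} → Recursive {2} F → Recursive₂ (λ x y → F (x ∷ y ∷ []))
binary (r , r⇓) = r , λ x y → r⇓ (x ∷ y ∷ [])

primrec₁ : ∀ (f : ℕ → ℕ) {H : Vec ℕ 2 → ℕ} → Recursive H → (∀ k → H (k ∷ f k ∷ []) ≡ f (suc k)) → Recursive₁ f
primrec₁ f {H} (h , h⇓) step = prec (proj₁ c) h , go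
  where
  c = const-recursive {0} (f 0)
  go : ∀ x → prec (proj₁ c) h [ x ∷ [] ]⇓ f x
  go zero    = prec-zero⇓ (proj₂ c [])
  go (suc x) = subst (prec _ h [ suc x ∷ [] ]⇓_) (step x) (prec-suc⇓ (go x) (h⇓ _))

primrec₂ : ∀ (f : ℕ → ℕ → ℕ) {G : Vec ℕ 1 → ℕ} {H : Vec ℕ 3 → ℕ} → Recursive G → Recursive H →
           (∀ y → G (y ∷ []) ≡ f 0 y) → (∀ k y → H (k ∷ f k y ∷ y ∷ []) ≡ f (suc k) y) → Recursive₂ f
primrec₂ f (g , g⇓) (h , h⇓) base step = prec g h , go
  where
  go : ∀ x y → prec g h [ x ∷ y ∷ [] ]⇓ f x y
  go zero    y = subst (prec g h [ 0 ∷ y ∷ [] ]⇓_) (base y) (prec-zero⇓ (g⇓ _))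
  go (suc x) y = subst (prec g h [ suc x ∷ y ∷ [] ]⇓_) (step x y) (prec-suc⇓ (go x y) (h⇓ _))


+-recursive : Recursive₂ ℕ._+_
+-recursive = primrec₂ ℕ._+_ (var 0F) (suc-recursive (var 1F)) (λ _ → refl) (λ _ _ → refl)

*-recursive : Recursive₂ ℕ._*_
*-recursive = primrec₂ ℕ._*_ (const-recursive 0) (app₂ +-recursive (var 2F) (var 1F)) (λ _ → refl) (λ _ _ → refl)

pred-recursive : Recursive₁ ℕ.pred
pred-recursive = primrec₁ ℕ.pred (var 0F) (λ _ → refl)

∸-recursive : Recursive₂ ℕ._∸_
∸-recursive = binary (app₂ flipped (var 1F) (var 0F))
  where
  flipped : Recursive₂ (λ n m → m ℕ.∸ n)
  flipped = primrec₂ (λ n m → m ℕ.∸ n) (var 0F) (app₁ pred-recursive (var 1F)) (λ _ → refl) (λ k m → ℕₚ.pred[m∸n]≡m∸[1+n] m k)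

^-recursive : ∀ c → Recursive₁ (c ℕ.^_)
^-recursive c = primrec₁ (c ℕ.^_) (app₂ *-recursive (const-recursive c) (var 1F)) (λ _ → refl)

-- Primitive recursive decoding of `codeTString`: the parity of a code tells whether □ is present,
-- and half of it is the code of the underlying string.
odd half : ℕ → ℕ
odd zero    = 0
odd (suc n) = 1 ℕ.∸ odd n
half zero      = 0
half (suc n)   = half n ℕ.+ odd n

odd-recursive : Recursive₁ odd
odd-recursive = primrec₁ odd (app₂ ∸-recursive (const-recursive 1) (var 1F)) (λ _ → refl)

half-recursive : Recursive₁ half
half-recursive = primrec₁ half (app₂ +-recursive (var 1F) (app₁ odd-recursive (var 0F))) (λ _ → refl)

odd-even : ∀ n → odd (2 ℕ.* n) ≡ 0
odd-even zero    = refl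
odd-even (suc n) rewrite ℕₚ.+-suc n (n ℕ.+ 0) | odd-even n = refl

half-even : ∀ n → half (2 ℕ.* n) ≡ n
half-even zero    = refl
half-even (suc n) rewrite ℕₚ.+-suc n (n ℕ.+ 0) | odd-even n | half-even n | ℕₚ.+-identityʳ n = ℕₚ.+-comm n 1

half-odd : ∀ n → half (1 ℕ.+ 2 ℕ.* n) ≡ n
half-odd n rewrite odd-even n | half-even n = ℕₚ.+-identityʳ n

-- The strings of length n have the codes 2ⁿ − 1, …, 2ⁿ⁺¹ − 2.
2^length≤ : ∀ w → 2 ℕ.^ length w ℕ.≤ 1 ℕ.+ codeString w
2^length≤ []      = ℕₚ.≤-refl
2^length≤ (b ∷ w) = ℕₚ.≤-trans doubled (bit b)
  where
  doubled : 2 ℕ.* 2 ℕ.^ length w ℕ.≤ 2 ℕ.+ 2 ℕ.* codeString w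
  doubled = subst (2 ℕ.* 2 ℕ.^ length w ℕ.≤_) (ℕₚ.*-distribˡ-+ 2 1 (codeString w)) (ℕₚ.*-monoʳ-≤ 2 (2^length≤ w))
  bit : ∀ b → 2 ℕ.+ 2 ℕ.* codeString w ℕ.≤ 1 ℕ.+ codeString (b ∷ w)
  bit false = ℕₚ.≤-refl
  bit true  = ℕₚ.n≤1+n _

<2^length : ∀ w → 2 ℕ.+ codeString w ℕ.≤ 2 ℕ.^ suc (length w)
<2^length []      = ℕₚ.≤-refl
<2^length (b ∷ w) = ℕₚ.≤-trans (bit b) doubled
  where
  doubled : 4 ℕ.+ 2 ℕ.* codeString w ℕ.≤ 2 ℕ.* 2 ℕ.^ suc (length w)
  doubled = subst (ℕ._≤ 2 ℕ.* 2 ℕ.^ suc (length w)) (ℕₚ.*-distribˡ-+ 2 2 (codeString w)) (ℕₚ.*-monoʳ-≤ 2 (<2^length w))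
  bit : ∀ b → 2 ℕ.+ codeString (b ∷ w) ℕ.≤ 4 ℕ.+ 2 ℕ.* codeString w
  bit false = ℕₚ.n≤1+n _
  bit true  = ℕₚ.≤-refl

-- The length of `w` is the least k with 2 + `codeString w` ≤ 2^(k+1), that is, the first zero of a
-- truncated difference. The operator `mu` also requires the earlier values to be successors, which
-- `exceeded` supplies.
length-recursive : Σ[ r ∈ Rec 1 ] (∀ w → r [ codeString w ∷ [] ]⇓ length w)
length-recursive = mu (proj₁ f) , λ w → mu⇓
    (λ i i<n → _ , subst (proj₁ f [ i ∷ codeString w ∷ [] ]⇓_) (exceeded w i<n) (proj₂ f i (codeString w)))
    (subst (proj₁ f [ length w ∷ codeString w ∷ [] ]⇓_) (ℕₚ.m≤n⇒m∸n≡0 (<2^length w)) (proj₂ f (length w) (codeString w)))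
  where
  f : Recursive₂ (λ k x → (2 ℕ.+ x) ℕ.∸ 2 ℕ.^ suc k)
  f = binary (app₂ ∸-recursive (suc-recursive (suc-recursive (var 1F))) (app₁ (^-recursive 2) (suc-recursive (var 0F))))
  exceeded : ∀ w {i} → i ℕ.< length w → (2 ℕ.+ codeString w) ℕ.∸ 2 ℕ.^ suc i ≡ suc (1 ℕ.+ codeString w ℕ.∸ 2 ℕ.^ suc i)
  exceeded w {i} i<n = ℕₚ.+-∸-assoc 1 (ℕₚ.≤-trans (ℕₚ.^-monoʳ-≤ 2 i<n) (2^length≤ w))

-- Weighted lower semicomputable functions

RecursiveOn : {D : Set} → (D → ℕ) → (D → ℕ) → Set
RecursiveOn code g = Σ[ r ∈ Rec 1 ] (∀ x → r [ code x ∷ [] ]⇓ g x)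

module _ {D : Set} {code : D → ℕ} where

  code-recursive : RecursiveOn code code
  code-recursive = proj 0F , λ x → proj⇓

  recursiveOn-resp : ∀ {g h} → (∀ x → g x ≡ h x) → RecursiveOn code g → RecursiveOn code h
  recursiveOn-resp g≡h (r , r⇓) = r , λ x → subst (r [ code x ∷ [] ]⇓_) (g≡h x) (r⇓ x)

  recursiveOn-∘ : ∀ {D′ : Set} {code′ : D′ → ℕ} {g} {h : D → D′} → RecursiveOn code′ g →
                  RecursiveOn code (λ x → code′ (h x)) → RecursiveOn code (λ x → g (h x))
  recursiveOn-∘ {h = h} (g , g⇓) (k , k⇓) = comp g (k ∷ []) , λ x → comp⇓ (∷⇓ (k⇓ x) []⇓) (g⇓ (h x))

  compose₁ : ∀ {f g} → Recursive₁ f → RecursiveOn code g → RecursiveOn code (λ x → f (g x))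
  compose₁ (f , f⇓) (g , g⇓) = comp f (g ∷ []) , λ x → comp⇓ (∷⇓ (g⇓ x) []⇓) (f⇓ _)

  compose₂ : ∀ {f g h} → Recursive₂ f → RecursiveOn code g → RecursiveOn code h →
             RecursiveOn code (λ x → f (g x) (h x))
  compose₂ (f , f⇓) (g , g⇓) (h , h⇓) =
    comp f (g ∷ h ∷ []) , λ x → comp⇓ (∷⇓ (g⇓ x) (∷⇓ (h⇓ x) []⇓)) (f⇓ _ _)

-- Weights are nonnegative, so multiplying by one leaves the sign `σ` of an approximation alone and
-- acts on numerator and denominator only.
record Weight {D : Set} (code : D → ℕ) (c : D → ℚ) : Set where
  field
    num den       : D → ℕ
    num-recursive : RecursiveOn code num
    den-recursive : RecursiveOn code den
    value         : ∀ x → c x ≡ + num x / suc (den x)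

den-*-recursive : Recursive₂ (λ a b → b ℕ.+ a ℕ.* suc b)
den-*-recursive = binary (app₂ +-recursive (var 1F) (app₂ *-recursive (var 0F) (suc-recursive (var 1F))))

frac-* : ∀ a a′ b b′ → + a / suc b * (+ a′ / suc b′) ≡ + (a ℕ.* a′) / suc (b′ ℕ.+ b ℕ.* suc b′)
frac-* a a′ b b′ = trans (/-*-/ (+ a) (+ a′) b b′) (cong (_/ suc (b′ ℕ.+ b ℕ.* suc b′)) (sym (ℤₚ.pos-* a a′)))

weight-* : ∀ {D : Set} {code : D → ℕ} {c e : D → ℚ} → Weight code c → Weight code e → Weight code (λ x → c x * e x)
weight-* u v = record
  { num           = λ x → U.num x ℕ.* V.num x
  ; den           = λ x → V.den x ℕ.+ U.den x ℕ.* suc (V.den x)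
  ; num-recursive = compose₂ *-recursive U.num-recursive V.num-recursive
  ; den-recursive = compose₂ den-*-recursive U.den-recursive V.den-recursive
  ; value         = λ x → trans (cong₂ _*_ (U.value x) (V.value x)) (frac-* (U.num x) (V.num x) (U.den x) (V.den x))
  }
  where
  module U = Weight u
  module V = Weight v

fraction : ∀ {p} → 0ℚ < p → ∃₂ λ a b → p ≡ + a / suc b
fraction {p@(mkℚ (+ n) d _)}      _   = n , d , sym (↥p/↧p≡p p)
fraction {p@(mkℚ ℤ.-[1+ n ] d _)} 0<p = contradiction (negative⁻¹ p) (<-asym 0<p)

-- Denominators are stored as predecessors: 1 + `powDen m n` = (1 + m)^n.
powDen : ℕ → ℕ → ℕ
powDen m zero    = 0
powDen m (suc n) = powDen m n ℕ.+ m ℕ.* suc (powDen m n)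

powDen-recursive : ∀ m → Recursive₁ (powDen m)
powDen-recursive m = primrec₁ (powDen m) (app₂ den-*-recursive (const-recursive m) (var 1F)) (λ _ → refl)

frac-^ : ∀ a m n → (+ a / suc m) ^ n ≡ + (a ℕ.^ n) / suc (powDen m n)
frac-^ a m zero    = refl
frac-^ a m (suc n) = trans (cong (+ a / suc m *_) (frac-^ a m n)) (frac-* a (a ℕ.^ n) m (powDen m n))

weight-^ : ∀ {D : Set} {code g : D → ℕ} {p} → 0ℚ < p → RecursiveOn code g → Weight code (λ x → p ^ g x)
weight-^ {g = g} 0<p g-recursive with fraction 0<p
... | a , m , refl = record
  { num           = λ x → a ℕ.^ g x
  ; den           = λ x → powDen m (g x)
  ; num-recursive = compose₁ (^-recursive a) g-recursive
  ; den-recursive = compose₁ (powDen-recursive m) g-recursive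
  ; value         = λ x → frac-^ a m (g x)
  }

LowerSemicomputable-resp-≅ : ∀ {D : Set} {code : D → ℕ} {f g : D → ℝ⁺} → (∀ x → f x ≅ g x) →
  LowerSemicomputable code f → LowerSemicomputable code g
LowerSemicomputable-resp-≅ f≅g L = record
  { f̂          = f̂
  ; computable = computable
  ; monotone   = monotone
  ; below      = λ x t → lower-⊆ (proj₁ (f≅g x)) (below x t)
  ; converges  = λ x ε 0<ε → let T , h = converges x ε 0<ε in
      T , λ t T≤t → lower-⊆ (proj₁ (f≅g x)) (proj₁ (h t T≤t)) , upper-⊆ (proj₂ (f≅g x)) (proj₂ (h t T≤t))
  }
  where open LowerSemicomputable L

weighted-computable : ∀ {D D′ : Set} {code : D → ℕ} {code′ : D′ → ℕ} {f̂ : D → ℕ → ℚ}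
  (h : D′ → D) → RecursiveOn code′ (λ x → code (h x)) → {c : D′ → ℚ} → Weight code′ c →
  Computable code f̂ → Computable code′ (λ x t → c x * f̂ (h x) t)
weighted-computable {code = code} {code′} {f̂} h (hr , h⇓) {c} w C = record
  { σ          = λ x → σ (h x)
  ; α          = λ x t → num x ℕ.* α (h x) t
  ; β          = λ x t → β (h x) t ℕ.+ den x ℕ.* suc (β (h x) t)
  ; σ-rec      = at-h σ-rec
  ; α-rec      = comp (proj₁ *-recursive) (on-x (proj₁ num-recursive) ∷ at-h α-rec ∷ [])
  ; β-rec      = comp (proj₁ den-*-recursive) (on-x (proj₁ den-recursive) ∷ at-h β-rec ∷ [])
  ; σ-computed = λ x t → at-h⇓ x t (σ-computed (h x) t)
  ; α-computed = λ x t → comp⇓ (∷⇓ (on-x⇓ x t (proj₂ num-recursive x)) (∷⇓ (at-h⇓ x t (α-computed (h x) t)) []⇓)) (proj₂ *-recursive _ _)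
  ; β-computed = λ x t → comp⇓ (∷⇓ (on-x⇓ x t (proj₂ den-recursive x)) (∷⇓ (at-h⇓ x t (β-computed (h x) t)) []⇓)) (proj₂ den-*-recursive _ _)
  ; value      = λ x t → trans (cong₂ _*_ (Weight.value w x) (value (h x) t))
      (trans (/-*-/ (+ num x) ((-1ℤ ℤ.^ σ (h x) t) ℤ.* + α (h x) t) (den x) (β (h x) t))
        (cong (_/ suc (β (h x) t ℕ.+ den x ℕ.* suc (β (h x) t))) (numerator (num x) (-1ℤ ℤ.^ σ (h x) t) (α (h x) t))))
  }
  where
  open Computable C
  open Weight w using (num; den; num-recursive; den-recursive)
  on-x : Rec 1 → Rec 2
  on-x r = comp r (proj 0F ∷ [])
  at-h : Rec 2 → Rec 2
  at-h r = comp r (on-x hr ∷ proj 1F ∷ [])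
  on-x⇓ : ∀ {r} x t {y} → r [ code′ x ∷ [] ]⇓ y → on-x r [ code′ x ∷ t ∷ [] ]⇓ y
  on-x⇓ x t d = comp⇓ (∷⇓ proj⇓ []⇓) d
  at-h⇓ : ∀ {r} x t {y} → r [ code (h x) ∷ t ∷ [] ]⇓ y → at-h r [ code′ x ∷ t ∷ [] ]⇓ y
  at-h⇓ x t d = comp⇓ (∷⇓ (on-x⇓ x t (h⇓ x)) (∷⇓ proj⇓ []⇓)) d
  numerator : ∀ a s b → + a ℤ.* (s ℤ.* + b) ≡ s ℤ.* + (a ℕ.* b)
  numerator a s b = begin
    + a ℤ.* (s ℤ.* + b) ≡⟨ sym (ℤₚ.*-assoc (+ a) s (+ b)) ⟩
    + a ℤ.* s ℤ.* + b   ≡⟨ cong (ℤ._* + b) (ℤₚ.*-comm (+ a) s) ⟩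
    s ℤ.* + a ℤ.* + b   ≡⟨ ℤₚ.*-assoc s (+ a) (+ b) ⟩
    s ℤ.* (+ a ℤ.* + b) ≡⟨ cong (s ℤ.*_) (sym (ℤₚ.pos-* a b)) ⟩
    s ℤ.* + (a ℕ.* b)   ∎
    where open ≡-Reasoning

weighted-semicomputable : ∀ {D D′ : Set} {code : D → ℕ} {code′ : D′ → ℕ} {f : D → ℝ⁺}
  (h : D′ → D) → RecursiveOn code′ (λ x → code (h x)) → {c : D′ → ℚ} → (∀ x → 0ℚ < c x) → Weight code′ c →
  LowerSemicomputable code f → LowerSemicomputable code′ (λ x → ι (c x) ⊗ f (h x))
weighted-semicomputable {f = f} h h-recursive {c} 0<c w L = record
  { f̂          = λ x t → c x * f̂ (h x) t
  ; computable = weighted-computable h h-recursive w computable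
  ; monotone   = λ x t → *-monoˡ-≤-nonNeg (c x) {{nonNegative (<⇒≤ (0<c x))}} (monotone (h x) t)
  ; below      = λ x t → lower-scale (0<c x) (f (h x)) (below (h x) t)
  ; converges  = conv
  }
  where
  open LowerSemicomputable L
  conv : ∀ x ε → 0ℚ < ε → ∃[ T ] (∀ t → T ℕ.≤ t →
    lower (ι (c x) ⊗ f (h x)) (c x * f̂ (h x) t - ε) × upper (ι (c x) ⊗ f (h x)) (c x * f̂ (h x) t + ε))
  conv x ε 0<ε = T , λ t T≤t →
      subst (lower (ι (c x) ⊗ f (h x))) (minus (f̂ (h x) t)) (lower-scale (0<c x) (f (h x)) (proj₁ (close t T≤t))) ,
      subst (upper (ι (c x) ⊗ f (h x))) (plus (f̂ (h x) t)) (upper-scale (0<c x) (f (h x)) (proj₂ (close t T≤t)))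
    where
    open +-*-Solver
    open ≡-Reasoning
    i = reciprocal (0<c x)
    -- Scaling by `c x` turns the tolerance ε/`c x` into exactly ε.
    conv-h = converges (h x) (ε * i) (*-pos 0<ε (reciprocal-pos (0<c x)))
    T = proj₁ conv-h
    close = proj₂ conv-h
    plus : ∀ p → c x * (p + ε * i) ≡ c x * p + ε
    plus p = begin
      c x * (p + ε * i)         ≡⟨ solve 4 (λ c p e i → c :* (p :+ e :* i) := c :* p :+ e :* (i :* c)) refl (c x) p ε i ⟩
      c x * p + ε * (i * c x)   ≡⟨ cong (λ z → c x * p + ε * z) (reciprocal-inverse (0<c x)) ⟩
      c x * p + ε * 1ℚ          ≡⟨ cong (_+_ (c x * p)) (*-identityʳ ε) ⟩
      c x * p + ε               ∎
    minus : ∀ p → c x * (p - ε * i) ≡ c x * p - ε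
    minus p = begin
      c x * (p - ε * i)         ≡⟨ solve 4 (λ c p e i → c :* (p :- e :* i) := c :* p :- e :* (i :* c)) refl (c x) p ε i ⟩
      c x * p - ε * (i * c x)   ≡⟨ cong (λ z → c x * p - ε * z) (reciprocal-inverse (0<c x)) ⟩
      c x * p - ε * 1ℚ          ≡⟨ cong (λ z → c x * p - z) (*-identityʳ ε) ⟩
      c x * p - ε               ∎

-- From termgales to supergales

length-∷ʳ : ∀ (w : String) b → length (w ∷ʳ b) ≡ suc (length w)
length-∷ʳ w b = trans (length-++ w) (ℕₚ.+-comm (length w) 1)

opaque
  unfolding _⊕_ _⊗_ 2⁻_ ν

  -- From here on, these equations are the only passage between the opaque operations and those
  -- occurring in the definitions of supergales and termgales.
  ⊕-def : _⊕_ ≡ _+ᴿ_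
  ⊕-def = refl

  ⊗-def : _⊗_ ≡ _*ᴿ_
  ⊗-def = refl

  2⁻-def : 2⁻_ ≡ 2^-_
  2⁻-def = refl

  ν-def : ν ≡ fromℕ
  ν-def = refl

private
  -- With the operations as variables, no cut is unfolded.
  module _ {R : Set₁} {_∙_ _∙′_ _⊞_ _⊞′_ : R → R → R} {e e′ : R → R} {m m′ : ℕ → R} where

    average₂≡ : _∙_ ≡ _∙′_ → _⊞_ ≡ _⊞′_ → e ≡ e′ → ∀ s x y → (e s ∙ (x ⊞ y)) ≡ (e′ s ∙′ (x ⊞′ y))
    average₂≡ refl refl refl s x y = refl

    average₃≡ : _∙_ ≡ _∙′_ → _⊞_ ≡ _⊞′_ → e ≡ e′ → ∀ s x y z → (e s ∙ ((x ⊞ y) ⊞ z)) ≡ (e′ s ∙′ ((x ⊞′ y) ⊞′ z))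
    average₃≡ refl refl refl s x y z = refl

    discount≡ : _∙_ ≡ _∙′_ → e ≡ e′ → m ≡ m′ → ∀ s n x → (e (s ∙ m n) ∙ x) ≡ (e′ (s ∙′ m′ n) ∙′ x)
    discount≡ refl refl refl s n x = refl

module _ {s : ℝ⁺} {d : String → ℝ⁺} where

  private
    average≡ : ∀ w → 2⁻ s ⊗ (d (w ∷ʳ false) ⊕ d (w ∷ʳ true)) ≡ 2^- s *ᴿ (d (w ∷ʳ false) +ᴿ d (w ∷ʳ true))
    average≡ w = average₂≡ {m = ν} {ν} ⊗-def ⊕-def 2⁻-def s (d (w ∷ʳ false)) (d (w ∷ʳ true))

  supergale⇒⊑ : IsSupergale s d → ∀ w → 2⁻ s ⊗ (d (w ∷ʳ false) ⊕ d (w ∷ʳ true)) ⊑ d w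
  supergale⇒⊑ h w = ≤ᴿ⇒⊑ (subst (_≤ᴿ d w) (sym (average≡ w)) (h w))

  ⊑⇒supergale : (∀ w → 2⁻ s ⊗ (d (w ∷ʳ false) ⊕ d (w ∷ʳ true)) ⊑ d w) → IsSupergale s d
  ⊑⇒supergale h w = subst (_≤ᴿ d w) (average≡ w) (⊑⇒≤ᴿ (h w))

module _ {s : ℝ⁺} {d : TString → ℝ⁺} where

  private
    average≡ : ∀ w → 2⁻ s ⊗ (d (str (w ∷ʳ false)) ⊕ d (str (w ∷ʳ true)) ⊕ d (w □))
                   ≡ 2^- s *ᴿ (d (str (w ∷ʳ false)) +ᴿ d (str (w ∷ʳ true)) +ᴿ d (w □))
    average≡ w = average₃≡ {m = ν} {ν} ⊗-def ⊕-def 2⁻-def s (d (str (w ∷ʳ false))) (d (str (w ∷ʳ true))) (d (w □))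

  average⇒⊑ : IsTermgaleAt s d → ∀ w →
              2⁻ s ⊗ (d (str (w ∷ʳ false)) ⊕ d (str (w ∷ʳ true)) ⊕ d (w □)) ⊑ d (str w)
  average⇒⊑ h w = ≤ᴿ⇒⊑ (subst (_≤ᴿ d (str w)) (sym (average≡ w)) (IsTermgaleAt.average h w))

  ⊑⇒termgale : d (str []) ⊑ 1ᴿ →
               (∀ w → 2⁻ s ⊗ (d (str (w ∷ʳ false)) ⊕ d (str (w ∷ʳ true)) ⊕ d (w □)) ⊑ d (str w)) → IsTermgaleAt s d
  ⊑⇒termgale i a = record
    { initial = ⊑⇒≤ᴿ (⊑-trans i (subst (1ᴿ ⊑_) (cong (λ f → f 1) ν-def) (proj₁ (ι≅ν 1))))
    ; average = λ w → subst (_≤ᴿ d (str w)) (average≡ w) (⊑⇒≤ᴿ (a w))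
    }

private
  discount : ∀ s n x → 2⁻ (s ⊗ ν n) ⊗ x ≡ 2^- (s *ᴿ fromℕ n) *ᴿ x
  discount = discount≡ {_⊞_ = _⊕_} {_⊕_} ⊗-def 2⁻-def ν-def

gale-coherent : ∀ d s s′ x → 2⁻ (s ⊗ ν ∣ x ∣ᵀ) ⊗ gale d s x ≅ 2⁻ (s′ ⊗ ν ∣ x ∣ᵀ) ⊗ gale d s′ x
gale-coherent d s s′ x = subst₂ _≅_ (sym (discount s ∣ x ∣ᵀ (gale d s x))) (sym (discount s′ ∣ x ∣ᵀ (gale d s′ x)))
  (≤ᴿ⇒⊑ (proj₁ (coherent d s s′ x)) , ≤ᴿ⇒⊑ (proj₂ (coherent d s s′ x)))

≅⇒coherent : ∀ {s s′ n x y} → 2⁻ (s ⊗ ν n) ⊗ x ≅ 2⁻ (s′ ⊗ ν n) ⊗ y →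
             2^- (s *ᴿ fromℕ n) *ᴿ x ≈ᴿ 2^- (s′ *ᴿ fromℕ n) *ᴿ y
≅⇒coherent {s} {s′} {n} {x} {y} (p , q) = subst₂ _≈ᴿ_ (discount s n x) (discount s′ n y) (⊑⇒≤ᴿ p , ⊑⇒≤ᴿ q)

2⁻-fromℕ0 : 2⁻ (fromℕ 0) ≅ 1ᴿ
2⁻-fromℕ0 = 2⁻-0 (subst (_⊑ ν 0) (cong (λ f → f 0) ν-def) ⊑-refl)

2⁻-fromℕ0-⊗ : ∀ x → 2⁻ (fromℕ 0 ⊗ x) ≅ 1ᴿ
2⁻-fromℕ0-⊗ x = 2⁻-0 (subst (λ z → z ⊗ x ⊑ ν 0) (cong (λ f → f 0) ν-def) (⊗-zeroˡ x (ν 0)))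

⊗-scale : ∀ {a b} → 0ℚ ≤ a → 0ℚ ≤ b → ∀ x → ι (a * b) ⊗ x ≅ ι a ⊗ (ι b ⊗ x)
⊗-scale 0≤a 0≤b x = ≅-trans (⊗-cong (swap (ι-* 0≤a 0≤b)) ≅-refl) (⊗-assoc _ _ _)

⊗-swap : ∀ x y z → x ⊗ (y ⊗ z) ≅ y ⊗ (x ⊗ z)
⊗-swap x y z = ≅-trans (swap (⊗-assoc x y z)) (≅-trans (⊗-cong (⊗-comm x y) ≅-refl) (⊗-assoc y x z))

-- Bernoulli's inequality gives η^N ≥ 1 + N(η - 1), and N is an Archimedean bound for M/(ρ(η - 1)).
unbounded : ∀ {ρ η} → 0ℚ < ρ → 1ℚ < η → ∀ M → ∃[ N ] (∀ n → N ℕ.≤ n → M < ρ * η ^ n)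
unbounded {ρ} {η} 0<ρ 1<η M = N , bound
  where
  open ≤-Reasoning
  open +-*-Solver
  0<D : 0ℚ < ρ * (η - 1ℚ)
  0<D = *-pos 0<ρ (p<q⇒0<q-p 1<η)
  i = reciprocal 0<D
  k = proj₁ (archimedean (M * i) 0)
  N = suc k
  bound : ∀ n → N ℕ.≤ n → M < ρ * η ^ n
  bound n N≤n = begin-strict
    M                                ≡⟨ sym (*-identityʳ M) ⟩
    M * 1ℚ                           ≡⟨ cong (M *_) (sym (reciprocal-inverse 0<D)) ⟩
    M * (i * (ρ * (η - 1ℚ)))         ≡⟨ sym (*-assoc M i (ρ * (η - 1ℚ))) ⟩
    M * i * (ρ * (η - 1ℚ))           <⟨ *-monoˡ-<-pos (ρ * (η - 1ℚ)) {{positive 0<D}} (proj₂ (archimedean (M * i) 0)) ⟩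
    + N / 1 * (ρ * (η - 1ℚ))         ≡⟨ solve 3 (λ n r d → n :* (r :* d) := r :* (con 0ℚ :+ n :* d)) refl (+ N / 1) ρ (η - 1ℚ) ⟩
    ρ * (0ℚ + + N / 1 * (η - 1ℚ))    ≤⟨ *-monoˡ-≤-nonNeg ρ {{nonNegative (<⇒≤ 0<ρ)}} (+-monoˡ-≤ (+ N / 1 * (η - 1ℚ)) 0≤1) ⟩
    ρ * (1ℚ + + N / 1 * (η - 1ℚ))    ≤⟨ *-monoˡ-≤-nonNeg ρ {{nonNegative (<⇒≤ 0<ρ)}} bern ⟩
    ρ * η ^ N                        ≡⟨ cong (ρ *_) (sym (*-identityʳ (η ^ N))) ⟩
    ρ * (η ^ N * 1ℚ)                 ≤⟨ *-monoˡ-≤-nonNeg ρ {{nonNegative (<⇒≤ 0<ρ)}}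
                                         (*-monoˡ-≤-nonNeg (η ^ N) {{nonNegative (^-nonneg N (<⇒≤ (<-trans 0<1 1<η)))}} (1≤^ (n ℕ.∸ N) (<⇒≤ 1<η))) ⟩
    ρ * (η ^ N * η ^ (n ℕ.∸ N))      ≡⟨ cong (ρ *_) (sym (^-homo-* η N (n ℕ.∸ N))) ⟩
    ρ * η ^ (N ℕ.+ (n ℕ.∸ N))        ≡⟨ cong (λ m → ρ * η ^ m) (ℕₚ.m+[n∸m]≡n N≤n) ⟩
    ρ * η ^ n                        ∎
    where
    bern : 1ℚ + + N / 1 * (η - 1ℚ) ≤ η ^ N
    bern = begin
      1ℚ + + N / 1 * (η - 1ℚ)            ≡⟨ sym (*-identityˡ _) ⟩
      1ℚ * (1ℚ + + N / 1 * (η - 1ℚ))     ≡⟨ cong (_* (1ℚ + + N / 1 * (η - 1ℚ))) (sym (1^ N)) ⟩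
      1ℚ ^ N * (1ℚ + + N / 1 * (η - 1ℚ)) ≤⟨ bernoulli 0≤1 (<⇒≤ 1<η) N ⟩
      η ^ N * 1ℚ                         ≡⟨ *-identityʳ _ ⟩
      η ^ N                              ∎

reciprocal>1 : ∀ {θ} (0<θ : 0ℚ < θ) → θ < 1ℚ → 1ℚ < reciprocal 0<θ
reciprocal>1 0<θ θ<1 = <reciprocal {q = 1ℚ} 0<θ (subst (_< 1ℚ) (sym (*-identityˡ _)) θ<1)

-- At s = 0 a termgale is a measure on prefixes with the mass of w□ below w.
module MeasureOf (d : Termgale) where

  μ : TString → ℝ⁺
  μ = gale d (fromℕ 0)

  subadditive : ∀ w → μ (str (w ∷ʳ false)) ⊕ μ (str (w ∷ʳ true)) ⊕ μ (w □) ⊑ μ (str w)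
  subadditive w = begin
    μ (str (w ∷ʳ false)) ⊕ μ (str (w ∷ʳ true)) ⊕ μ (w □)                       ≈⟨ swap (⊗-identityˡ _) ⟩
    1ᴿ ⊗ (μ (str (w ∷ʳ false)) ⊕ μ (str (w ∷ʳ true)) ⊕ μ (w □))                ≈⟨ ⊗-cong (swap 2⁻-fromℕ0) ≅-refl ⟩
    2⁻ (fromℕ 0) ⊗ (μ (str (w ∷ʳ false)) ⊕ μ (str (w ∷ʳ true)) ⊕ μ (w □))      ≤⟨ average⇒⊑ (isTermgale d (fromℕ 0)) w ⟩
    μ (str w)                                                                   ∎
    where open ⊑-Reasoning

  children⊑ : ∀ w → μ (str (w ∷ʳ false)) ⊕ μ (str (w ∷ʳ true)) ⊑ μ (str w)
  children⊑ w = ⊑-trans (x⊑x+y _ _) (subadditive w)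

  μ□⊑μ : ∀ w → μ (w □) ⊑ μ (str w)
  μ□⊑μ w = ⊑-trans (y⊑x+y _ _) (subadditive w)

  2⁻⊗gale≅μ : ∀ s x → 2⁻ (s ⊗ ν ∣ x ∣ᵀ) ⊗ gale d s x ≅ μ x
  2⁻⊗gale≅μ s x = begin-equality
    2⁻ (s ⊗ ν ∣ x ∣ᵀ) ⊗ gale d s x  ≈⟨ gale-coherent d s (fromℕ 0) x ⟩
    2⁻ (fromℕ 0 ⊗ ν ∣ x ∣ᵀ) ⊗ μ x   ≈⟨ ⊗-cong (2⁻-fromℕ0-⊗ (ν ∣ x ∣ᵀ)) ≅-refl ⟩
    1ᴿ ⊗ μ x                        ≈⟨ ⊗-identityˡ (μ x) ⟩
    μ x                             ∎
    where open ⊑-Reasoning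

  -- Coherence with s = 0 turns `gale d s (w □)` into μ(w□) at the price of 2^(-s(|w|+1)). Bounding
  -- this by powers of a rational ρ makes the estimate uniform in all `s` with ρ ≤ 2^(-s).
  power⊑μ□ : ∀ {ρ s w} → 0ℚ ≤ ρ → ι ρ ⊑ 2⁻ s → fromℕ 1 <ᴿ gale d s (w □) → ι (ρ ^ suc (length w)) ⊑ μ (w □)
  power⊑μ□ {ρ} {s} {w} 0≤ρ ρ⊑ (q , 1<q , l) = begin
    ι (ρ ^ suc (length w))                        ≈⟨ swap (ι-^ 0≤ρ (suc (length w))) ⟩
    ι ρ ^ᴿ suc (length w)                         ≤⟨ ^ᴿ-mono (suc (length w)) ρ⊑ ⟩
    (2⁻ s) ^ᴿ suc (length w)                      ≈⟨ swap (2⁻-⊗ s (suc (length w))) ⟩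
    2⁻ (s ⊗ ν (suc (length w)))                   ≈⟨ swap (⊗-identityʳ _) ⟩
    2⁻ (s ⊗ ν (suc (length w))) ⊗ 1ᴿ              ≤⟨ ⊗-mono ⊑-refl (ι-⊑ 0≤1 (lower-down (gale d s (w □)) 1<q l)) ⟩
    2⁻ (s ⊗ ν (suc (length w))) ⊗ gale d s (w □)  ≈⟨ 2⁻⊗gale≅μ s (w □) ⟩
    μ (w □)                                       ∎
    where open ⊑-Reasoning

str-recursive : RecursiveOn codeString (λ w → codeTString (str w))
str-recursive = compose₁ (unary (app₂ *-recursive (const-recursive 2) (var 0F))) code-recursive

module ScaledMeasure (d : Termgale) {τ s} (0<τ : 0ℚ < τ) (2⁻s⊑τ : 2⁻ s ⊑ ι τ) where
  open MeasureOf d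

  β : ℚ
  β = reciprocal 0<τ

  0<β : 0ℚ < β
  0<β = reciprocal-pos 0<τ

  scaled : String → ℝ⁺
  scaled w = ι (β ^ length w) ⊗ μ (str w)

  0≤β^ : ∀ n → 0ℚ ≤ β ^ n
  0≤β^ n = ^-nonneg n (<⇒≤ 0<β)

  scaled-semicomputable : IsConstructive d → LowerSemicomputable codeString scaled
  scaled-semicomputable = weighted-semicomputable str str-recursive (λ w → ^-pos (length w) 0<β) (weight-^ 0<β length-recursive)

  -- A further bit multiplies the weight by β = 1/τ, and 2^(-s) ≤ τ cancels this factor, so
  -- additivity losses of μ are the only ones.
  scaled-supergale : IsSupergale s scaled
  scaled-supergale = ⊑⇒supergale λ w → let n = length w ; x = μ (str (w ∷ʳ false)) ; y = μ (str (w ∷ʳ true)) in begin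
    2⁻ s ⊗ (ι (β ^ length (w ∷ʳ false)) ⊗ x ⊕ ι (β ^ length (w ∷ʳ true)) ⊗ y)
      ≡⟨ cong₂ (λ k l → 2⁻ s ⊗ (ι (β ^ k) ⊗ x ⊕ ι (β ^ l) ⊗ y)) (length-∷ʳ w false) (length-∷ʳ w true) ⟩
    2⁻ s ⊗ (ι (β ^ suc n) ⊗ x ⊕ ι (β ^ suc n) ⊗ y)
      ≈⟨ ⊗-cong ≅-refl (swap (⊗-distribˡ (ι (β ^ suc n)) x y)) ⟩
    2⁻ s ⊗ (ι (β ^ suc n) ⊗ (x ⊕ y))
      ≤⟨ ⊗-mono 2⁻s⊑τ (⊗-mono ⊑-refl (children⊑ w)) ⟩
    ι τ ⊗ (ι (β ^ suc n) ⊗ μ (str w))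
      ≈⟨ swap (⊗-scale {τ} {β ^ suc n} (<⇒≤ 0<τ) (0≤β^ (suc n)) (μ (str w))) ⟩
    ι (τ * (β * β ^ n)) ⊗ μ (str w)
      ≡⟨ cong (λ z → ι z ⊗ μ (str w)) (cancel n) ⟩
    ι (β ^ n) ⊗ μ (str w) ∎
    where
    open ⊑-Reasoning
    cancel : ∀ n → τ * (β * β ^ n) ≡ β ^ n
    cancel n = trans (sym (*-assoc τ β (β ^ n)))
      (trans (cong (_* β ^ n) (trans (*-comm τ β) (reciprocal-inverse 0<τ))) (*-identityˡ (β ^ n)))

module _ (d : Termgale) {ρ θ r : ℚ} {s : ℝ⁺} (0<ρ : 0ℚ < ρ) (0<θ : 0ℚ < θ) (θ<1 : θ < 1ℚ)
         (ρ⊑ : ι ρ ⊑ 2⁻ ι r) (⊑θρ : 2⁻ s ⊑ ι (θ * ρ)) where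
  open MeasureOf d
  open ScaledMeasure d {θ * ρ} {s} (*-pos 0<θ 0<ρ) ⊑θρ

  private
    η : ℚ
    η = reciprocal 0<θ

    βρ≡η : β * ρ ≡ η
    βρ≡η = begin
      β * ρ               ≡⟨ sym (*-identityʳ (β * ρ)) ⟩
      β * ρ * 1ℚ          ≡⟨ cong (β * ρ *_) (sym (reciprocal-inverse 0<θ)) ⟩
      β * ρ * (η * θ)     ≡⟨ solve 4 (λ b r e t → b :* r :* (e :* t) := b :* (t :* r) :* e) refl β ρ η θ ⟩
      β * (θ * ρ) * η     ≡⟨ cong (_* η) (reciprocal-inverse (*-pos 0<θ 0<ρ)) ⟩
      1ℚ * η              ≡⟨ *-identityˡ η ⟩
      η                   ∎
      where
      open ≡-Reasoning
      open +-*-Solver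

    -- The weight has one factor β per bit, while the lower bound for μ(w□) has one more factor ρ
    -- for □; the surplus ρ stays outside the growing power of η = 1/θ.
    mass : ∀ n → β ^ n * ρ ^ suc n ≡ ρ * η ^ n
    mass n = begin
      β ^ n * (ρ * ρ ^ n) ≡⟨ solve 3 (λ b r x → b :* (r :* x) := r :* (b :* x)) refl (β ^ n) ρ (ρ ^ n) ⟩
      ρ * (β ^ n * ρ ^ n) ≡⟨ cong (ρ *_) (sym (^-distrib-* β ρ n)) ⟩
      ρ * (β * ρ) ^ n     ≡⟨ cong (λ z → ρ * z ^ n) βρ≡η ⟩
      ρ * η ^ n           ∎
      where
      open ≡-Reasoning
      open +-*-Solver

    growing : ∀ {t w} → upper t r → fromℕ 1 <ᴿ gale d t (w □) → ι (ρ * η ^ length w) ⊑ scaled w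
    growing {t} {w} u 1<g = begin
      ι (ρ * η ^ n)                ≡⟨ cong ι (sym (mass n)) ⟩
      ι (β ^ n * ρ ^ suc n)        ≈⟨ swap (ι-* {β ^ n} {ρ ^ suc n} (0≤β^ n) (^-nonneg (suc n) (<⇒≤ 0<ρ))) ⟩
      ι (β ^ n) ⊗ ι (ρ ^ suc n)    ≤⟨ ⊗-mono ⊑-refl (⊑-trans (power⊑μ□ {ρ} {t} {w} (<⇒≤ 0<ρ) (⊑-trans ρ⊑ (2⁻-mono (⊑-ι u))) 1<g) (μ□⊑μ w)) ⟩
      ι (β ^ n) ⊗ μ (str w)        ∎
      where
      open ⊑-Reasoning
      n = length w

  scaled-succeeds : ∀ {S} → (∀ n → ∃[ k ] ∃[ t ] upper t r × fromℕ 1 <ᴿ gale d t ((S ↾ (n ℕ.+ k)) □)) → Succeeds scaled S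
  scaled-succeeds {S} h M n = m , ℕₚ.≤-trans (ℕₚ.m≤m+n n N) (ℕₚ.m≤m+n (n ℕ.+ N) k) ,
    lower-⊆ (growing {w = S ↾ m} (proj₁ (proj₂ (proj₂ hk))) (proj₂ (proj₂ (proj₂ hk)))) (ι-lower (proj₂ (unbounded 0<ρ (reciprocal>1 0<θ θ<1) M) (length (S ↾ m))
      (subst (N ℕ.≤_) (sym (length-applyUpTo S m)) (ℕₚ.≤-trans (ℕₚ.m≤n+m N n) (ℕₚ.m≤m+n (n ℕ.+ N) k)))))
    where
    N = proj₁ (unbounded 0<ρ (reciprocal>1 0<θ θ<1) M)
    -- Prefixes of length at least `N` give values above `M`; the summand `n` places the prefix in
    -- the required tail.
    hk = h (n ℕ.+ N)
    k = proj₁ hk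
    m = n ℕ.+ N ℕ.+ k

dimSequence≤liminf : ∀ d → IsConstructive d → ∀ S q →
  above (liminf (λ n → dimString d (S ↾ n))) q → above (dimSequence S) q
dimSequence≤liminf d d-constructive S q (r , r<q , h) = go (<-dense r<q)
  where
  -- Some prefix has an admissible exponent `t` below `r`, and exponents are nonnegative.
  0<r : 0ℚ < r
  0<r = let k , t , _ , u = h 0 in upper-pos t u
  go : ∃[ p ] r < p × p < q → above (dimSequence S) q
  go (p , r<p , p<q) = let ρ , θ , 0<ρ , 0<θ , θ<1 , ρ⊑ , ⊑θρ = 2⁻-gap 0<r r<p in
    ι p ,
    (scaled d (*-pos 0<θ 0<ρ) ⊑θρ , scaled-supergale d (*-pos 0<θ 0<ρ) ⊑θρ ,
     scaled-semicomputable d (*-pos 0<θ 0<ρ) ⊑θρ d-constructive ,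
     scaled-succeeds d {r = r} 0<ρ 0<θ θ<1 ρ⊑ ⊑θρ {S} (λ n → let k , t , lift 1<g , u = h n in k , t , u , 1<g)) ,
    ι-upper (<⇒≤ (<-trans 0<r r<p)) p<q
    where open ScaledMeasure

-- From supergales to termgales

opaque
  -- This is 2^(sn). As the exponents of `2⁻` are nonnegative, it has to be obtained as an inverse.
  exp₂ : ℝ⁺ → ℕ → ℝ⁺
  exp₂ s n = inv (2⁻ (s ⊗ ν n)) (2⁻-lower-pos (s ⊗ ν n))

  exp₂-inverse : ∀ s n → 2⁻ (s ⊗ ν n) ⊗ exp₂ s n ≅ 1ᴿ
  exp₂-inverse s n = inv-inverse (2⁻ (s ⊗ ν n)) (2⁻-lower-pos (s ⊗ ν n))

exp₂-suc : ∀ s n → 2⁻ s ⊗ exp₂ s (suc n) ≅ exp₂ s n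
exp₂-suc s n = begin-equality
  2⁻ s ⊗ E′                                ≈⟨ swap (⊗-identityˡ (2⁻ s ⊗ E′)) ⟩
  1ᴿ ⊗ (2⁻ s ⊗ E′)                         ≈⟨ ⊗-cong (swap (exp₂-inverse s n)) ≅-refl ⟩
  (P ⊗ E) ⊗ (2⁻ s ⊗ E′)                    ≈⟨ ⊗-cong (⊗-comm P E) ≅-refl ⟩
  (E ⊗ P) ⊗ (2⁻ s ⊗ E′)                    ≈⟨ ⊗-assoc E P (2⁻ s ⊗ E′) ⟩
  E ⊗ (P ⊗ (2⁻ s ⊗ E′))                    ≈⟨ ⊗-cong ≅-refl (⊗-swap P (2⁻ s) E′) ⟩
  E ⊗ (2⁻ s ⊗ (P ⊗ E′))                    ≈⟨ ⊗-cong ≅-refl (swap (⊗-assoc (2⁻ s) P E′)) ⟩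
  E ⊗ ((2⁻ s ⊗ P) ⊗ E′)                    ≈⟨ ⊗-cong ≅-refl (⊗-cong (swap (2⁻-⊗-suc s n)) ≅-refl) ⟩
  E ⊗ (2⁻ (s ⊗ ν (suc n)) ⊗ E′)            ≈⟨ ⊗-cong ≅-refl (exp₂-inverse s (suc n)) ⟩
  E ⊗ 1ᴿ                                   ≈⟨ ⊗-identityʳ E ⟩
  E                                        ∎
  where
  open ⊑-Reasoning
  E  = exp₂ s n
  E′ = exp₂ s (suc n)
  P  = 2⁻ (s ⊗ ν n)

exp₂≅1 : ∀ {s n} → 2⁻ (s ⊗ ν n) ≅ 1ᴿ → exp₂ s n ≅ 1ᴿ
exp₂≅1 {s} {n} e = ≅-trans (swap (⊗-identityˡ (exp₂ s n))) (≅-trans (⊗-cong (swap e) ≅-refl) (exp₂-inverse s n))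

exp₂-cancel : ∀ s n x → 2⁻ (s ⊗ ν n) ⊗ (exp₂ s n ⊗ x) ≅ x
exp₂-cancel s n x = ≅-trans (swap (⊗-assoc _ _ x)) (≅-trans (⊗-cong (exp₂-inverse s n) ≅-refl) (⊗-identityˡ x))

-- Inserting 1 = 2^(-sn) · 2^(sn) next to τ^(-n) and bounding 2^(-sn) by τ^n avoids having to invert
-- an inequality between reals.
exp₂-lower-bound : ∀ {s τ} (0<τ : 0ℚ < τ) → 2⁻ s ⊑ ι τ → ∀ n → ι (reciprocal (^-pos n 0<τ)) ⊑ exp₂ s n
exp₂-lower-bound {s} {τ} 0<τ s⊑τ n = begin
  ι i                                  ≈⟨ swap (⊗-identityʳ (ι i)) ⟩
  ι i ⊗ 1ᴿ                             ≈⟨ ⊗-cong ≅-refl (swap (exp₂-inverse s n)) ⟩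
  ι i ⊗ (2⁻ (s ⊗ ν n) ⊗ exp₂ s n)      ≤⟨ ⊗-mono ⊑-refl (⊗-mono (⊑-trans (proj₁ (2⁻-⊗ s n)) (⊑-trans (^ᴿ-mono n s⊑τ) (proj₁ (ι-^ (<⇒≤ 0<τ) n)))) ⊑-refl) ⟩
  ι i ⊗ (ι (τ ^ n) ⊗ exp₂ s n)         ≈⟨ swap (⊗-scale {i} {τ ^ n} (<⇒≤ (reciprocal-pos (^-pos n 0<τ))) (^-nonneg n (<⇒≤ 0<τ)) (exp₂ s n)) ⟩
  ι (i * τ ^ n) ⊗ exp₂ s n             ≡⟨ cong (λ z → ι z ⊗ exp₂ s n) (reciprocal-inverse (^-pos n 0<τ)) ⟩
  1ᴿ ⊗ exp₂ s n                        ≈⟨ ⊗-identityˡ (exp₂ s n) ⟩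
  exp₂ s n                             ∎
  where
  open ⊑-Reasoning
  i : ℚ
  i = reciprocal (^-pos n 0<τ)

module TermgaleOf (m : TString → ℝ⁺) (initial : m (str []) ⊑ 1ᴿ)
  (subadditive : ∀ w → m (str (w ∷ʳ false)) ⊕ m (str (w ∷ʳ true)) ⊕ m (w □) ⊑ m (str w)) where

  -- Coherence leaves no choice: the member at s = 0 determines all others by the factor 2^(s|x|).
  family : ℝ⁺ → TString → ℝ⁺
  family s x = exp₂ s ∣ x ∣ᵀ ⊗ m x

  average : ∀ s w → 2⁻ s ⊗ (family s (str (w ∷ʳ false)) ⊕ family s (str (w ∷ʳ true)) ⊕ family s (w □)) ⊑ family s (str w)
  average s w = begin
    2⁻ s ⊗ (exp₂ s (length (w ∷ʳ false)) ⊗ x ⊕ exp₂ s (length (w ∷ʳ true)) ⊗ y ⊕ E′ ⊗ z)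
      ≡⟨ cong₂ (λ k l → 2⁻ s ⊗ (exp₂ s k ⊗ x ⊕ exp₂ s l ⊗ y ⊕ E′ ⊗ z)) (length-∷ʳ w false) (length-∷ʳ w true) ⟩
    2⁻ s ⊗ (E′ ⊗ x ⊕ E′ ⊗ y ⊕ E′ ⊗ z)
      ≈⟨ ⊗-cong ≅-refl (⊕-cong (swap (⊗-distribˡ E′ x y)) ≅-refl) ⟩
    2⁻ s ⊗ (E′ ⊗ (x ⊕ y) ⊕ E′ ⊗ z)
      ≈⟨ ⊗-cong ≅-refl (swap (⊗-distribˡ E′ (x ⊕ y) z)) ⟩
    2⁻ s ⊗ (E′ ⊗ (x ⊕ y ⊕ z))
      ≈⟨ swap (⊗-assoc (2⁻ s) E′ (x ⊕ y ⊕ z)) ⟩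
    2⁻ s ⊗ E′ ⊗ (x ⊕ y ⊕ z)
      ≤⟨ ⊗-mono (proj₁ (exp₂-suc s (length w))) (subadditive w) ⟩
    exp₂ s (length w) ⊗ m (str w) ∎
    where
    open ⊑-Reasoning
    x = m (str (w ∷ʳ false))
    y = m (str (w ∷ʳ true))
    z = m (w □)
    E′ = exp₂ s (suc (length w))

  termgale : Termgale
  termgale = record
    { gale       = family
    ; isTermgale = λ s → ⊑⇒termgale
        (⊑-trans (⊗-mono (proj₁ (exp₂≅1 (2⁻-⊗-zero s))) initial) (proj₁ (⊗-identityˡ 1ᴿ))) (average s)
    ; coherent   = λ s s′ x → ≅⇒coherent {s} {s′} {∣ x ∣ᵀ} {family s x} {family s′ x}
        (≅-trans (exp₂-cancel s ∣ x ∣ᵀ (m x)) (swap (exp₂-cancel s′ ∣ x ∣ᵀ (m x))))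
    }

  termgale-constructive : LowerSemicomputable codeTString m → IsConstructive termgale
  termgale-constructive = LowerSemicomputable-resp-≅ λ x →
    swap (≅-trans (⊗-cong (exp₂≅1 (2⁻-fromℕ0-⊗ (ν ∣ x ∣ᵀ))) ≅-refl) (⊗-identityˡ (m x)))

base : TString → String
base (str w) = w
base (w □)   = w

base-recursive : RecursiveOn codeTString (λ x → codeString (base x))
base-recursive = recursiveOn-resp
  (λ { (str w) → half-even (codeString w) ; (w □) → half-odd (codeString w) })
  (compose₁ half-recursive code-recursive)

byTermination : {A : Set} → A → A → TString → A
byTermination a b (str w) = a
byTermination a b (w □)   = b

byTermination-recursive : ∀ a b → RecursiveOn codeTString (byTermination a b)
byTermination-recursive a b = recursiveOn-resp
  (λ { (str w) → cong select (odd-even (codeString w)) ; (w □) → cong (λ o → select (1 ℕ.∸ o)) (odd-even (codeString w)) })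
  (compose₁ (primrec₁ select (const-recursive b) (λ _ → refl)) (compose₁ odd-recursive code-recursive))
  where
  select : ℕ → ℕ
  select zero    = a
  select (suc _) = b

byTermination-weight : ∀ {p q} → 0ℚ < p → 0ℚ < q → Weight codeTString (byTermination p q)
byTermination-weight 0<p 0<q with fraction 0<p | fraction 0<q
... | a , b , refl | a′ , b′ , refl = record
  { num           = byTermination a a′
  ; den           = byTermination b b′
  ; num-recursive = byTermination-recursive a a′
  ; den-recursive = byTermination-recursive b b′
  ; value         = λ { (str w) → refl ; (w □) → refl }
  }

-- The supergale discounted to a measure loses a factor θ per bit, and the
-- mass 1 − θ that is set free at w goes to w□.
module MassOf (d : String → ℝ⁺) {s : ℝ⁺} (d-supergale : IsSupergale s d)
  {ρ θ κ : ℚ} (0<ρ : 0ℚ < ρ) (0<θ : 0ℚ < θ) (θ<1 : θ < 1ℚ) (0<κ : 0ℚ < κ)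
  (ρ⊑ : ι ρ ⊑ 2⁻ s) (κd⊑1 : ι κ ⊗ d [] ⊑ 1ᴿ) where

  τ κ□ : ℚ
  τ  = θ * ρ
  κ□ = κ * (1ℚ - θ)

  0<τ : 0ℚ < τ
  0<τ = *-pos 0<θ 0<ρ

  0<κ□ : 0ℚ < κ□
  0<κ□ = *-pos 0<κ (p<q⇒0<q-p θ<1)

  -- The exponent of τ does not count □, so w□ receives exactly the share 1 - θ of the mass of w.
  weight : TString → ℚ
  weight x = byTermination κ κ□ x * τ ^ length (base x)

  0<weight : ∀ x → 0ℚ < weight x
  0<weight (str w) = *-pos 0<κ (^-pos (length w) 0<τ)
  0<weight (w □)   = *-pos 0<κ□ (^-pos (length w) 0<τ)

  mass : TString → ℝ⁺
  mass x = ι (weight x) ⊗ d (base x)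

  mass-semicomputable : LowerSemicomputable codeString d → LowerSemicomputable codeTString mass
  mass-semicomputable = weighted-semicomputable base base-recursive 0<weight
    (weight-* (byTermination-weight 0<κ 0<κ□) (weight-^ 0<τ (recursiveOn-∘ {h = base} length-recursive base-recursive)))

  mass-initial : mass (str []) ⊑ 1ᴿ
  mass-initial = subst (λ z → ι z ⊗ d [] ⊑ 1ᴿ) (sym (*-identityʳ κ)) κd⊑1

  mass-subadditive : ∀ w → mass (str (w ∷ʳ false)) ⊕ mass (str (w ∷ʳ true)) ⊕ mass (w □) ⊑ mass (str w)
  mass-subadditive w = begin
    ι (κ * τ ^ length (w ∷ʳ false)) ⊗ x ⊕ ι (κ * τ ^ length (w ∷ʳ true)) ⊗ y ⊕ ι (κ□ * T) ⊗ z
      ≡⟨ cong₂ (λ k l → ι (κ * τ ^ k) ⊗ x ⊕ ι (κ * τ ^ l) ⊗ y ⊕ ι (κ□ * T) ⊗ z) (length-∷ʳ w false) (length-∷ʳ w true) ⟩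
    ι (κ * (τ * T)) ⊗ x ⊕ ι (κ * (τ * T)) ⊗ y ⊕ ι (κ□ * T) ⊗ z
      ≈⟨ ⊕-cong (swap (⊗-distribˡ (ι (κ * (τ * T))) x y)) ≅-refl ⟩
    ι (κ * (τ * T)) ⊗ (x ⊕ y) ⊕ ι (κ□ * T) ⊗ z
      ≡⟨ cong (λ c → ι c ⊗ (x ⊕ y) ⊕ ι (κ□ * T) ⊗ z) (regroup κ θ ρ T) ⟩
    ι (κ * T * θ * ρ) ⊗ (x ⊕ y) ⊕ ι (κ□ * T) ⊗ z
      ≈⟨ ⊕-cong (⊗-scale {κ * T * θ} {ρ} 0≤κTθ (<⇒≤ 0<ρ) (x ⊕ y)) ≅-refl ⟩
    ι (κ * T * θ) ⊗ (ι ρ ⊗ (x ⊕ y)) ⊕ ι (κ□ * T) ⊗ z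
      -- The factor ρ is spent on the supergale inequality; what the two children keep is the share
      -- θ.
      ≤⟨ ⊕-mono (⊗-mono ⊑-refl (⊑-trans (⊗-mono ρ⊑ ⊑-refl) (supergale⇒⊑ {s} {d} d-supergale w))) ⊑-refl ⟩
    ι (κ * T * θ) ⊗ z ⊕ ι (κ□ * T) ⊗ z
      ≈⟨ swap (⊗-distribʳ z (ι (κ * T * θ)) (ι (κ□ * T))) ⟩
    (ι (κ * T * θ) ⊕ ι (κ□ * T)) ⊗ z
      ≈⟨ ⊗-cong (ι-+ {κ * T * θ} {κ□ * T} 0≤κTθ (<⇒≤ (0<weight (w □)))) ≅-refl ⟩
    ι (κ * T * θ + κ□ * T) ⊗ z
      ≡⟨ cong (λ c → ι c ⊗ z) (total κ θ T) ⟩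
    ι (κ * T) ⊗ z ∎
    where
    open ⊑-Reasoning
    x y z : ℝ⁺
    x = d (w ∷ʳ false)
    y = d (w ∷ʳ true)
    z = d w
    T : ℚ
    T = τ ^ length w
    0≤κTθ : 0ℚ ≤ κ * T * θ
    0≤κTθ = *-nonneg (<⇒≤ (0<weight (str w))) (<⇒≤ 0<θ)
    regroup : ∀ κ θ ρ T → κ * (θ * ρ * T) ≡ κ * T * θ * ρ
    regroup = solve 4 (λ k t r T → k :* (t :* r :* T) := k :* T :* t :* r) refl
      where open +-*-Solver
    total : ∀ κ θ T → κ * T * θ + κ * (1ℚ - θ) * T ≡ κ * T
    total = solve 3 (λ k t T → k :* T :* t :+ k :* (con 1ℚ :- t) :* T := k :* T) refl
      where open +-*-Solver

  open TermgaleOf mass mass-initial mass-subadditive public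

  -- The scaling factor 2^(p(|w|+1)) is at least τ^(-(|w|+1)), which cancels τ^|w| in the mass. The
  -- power left over, due to □, gives the 1/τ in the constant.
  termgale-lower-bound : ∀ {p} → 2⁻ p ⊑ ι τ → ∀ w → ι (κ□ * reciprocal 0<τ) ⊗ d w ⊑ gale termgale p (w □)
  termgale-lower-bound {p} p⊑τ w = begin
    ι (κ□ * j) ⊗ d w                  ≡⟨ cong (λ c → ι c ⊗ d w) split ⟩
    ι (i * (κ□ * T)) ⊗ d w            ≈⟨ ⊗-scale {i} {κ□ * T} (<⇒≤ (reciprocal-pos (^-pos (suc n) 0<τ))) (<⇒≤ (0<weight (w □))) (d w) ⟩
    ι i ⊗ mass (w □)                  ≤⟨ ⊗-mono (exp₂-lower-bound 0<τ p⊑τ (suc n)) ⊑-refl ⟩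
    exp₂ p (suc n) ⊗ mass (w □)       ∎
    where
    open ⊑-Reasoning
    n : ℕ
    n = length w
    T i j : ℚ
    T = τ ^ n
    i = reciprocal (^-pos (suc n) 0<τ)
    j = reciprocal 0<τ
    split : κ□ * j ≡ i * (κ□ * T)
    split = trans (sym (*-identityʳ (κ□ * j)))
      (trans (cong (κ□ * j *_) (sym (reciprocal-inverse (^-pos (suc n) 0<τ))))
        (trans (shuffle κ□ j i τ T) (trans (cong (i * (κ□ * T) *_) (reciprocal-inverse 0<τ)) (*-identityʳ (i * (κ□ * T))))))
      where
      shuffle : ∀ k j i τ T → k * j * (i * (τ * T)) ≡ i * (k * T) * (j * τ)
      shuffle = solve 5 (λ k j i t T → k :* j :* (i :* (t :* T)) := i :* (k :* T) :* (j :* t)) refl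
        where open +-*-Solver

-- The real constant α is replaced by a positive rational `a` below it. The threshold 2/(ac) for `x`
-- then gives the value 2, a rational witness strictly above 1.
exceeds : ∀ {d□ d′ : Termgale} {α p c a} {x : ℝ⁺} {w} → α *ᴿ gale d′ p (w □) ≤ᴿ gale d□ p (w □) →
  (0<a : 0ℚ < a) → lower α a → (0<c : 0ℚ < c) → ι c ⊗ x ⊑ gale d′ p (w □) →
  lower x (2ℚ * reciprocal (*-pos 0<a 0<c)) → fromℕ 1 <ᴿ gale d□ p (w □)
exceeds {d□} {d′} {α} {p} {c} {a} {x} {w} α≤ 0<a la 0<c cx⊑ lx =
  2ℚ , 1<2 , lower-⊆ chain (subst (lower (ι (a * c) ⊗ x)) value (lower-scale 0<ac x lx))
  where
  open ⊑-Reasoning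
  0<ac : 0ℚ < a * c
  0<ac = *-pos 0<a 0<c
  value : a * c * (2ℚ * reciprocal 0<ac) ≡ 2ℚ
  value = trans (*-comm (a * c) (2ℚ * reciprocal 0<ac)) (trans (*-assoc 2ℚ (reciprocal 0<ac) (a * c))
    (trans (cong (2ℚ *_) (reciprocal-inverse 0<ac)) (*-identityʳ 2ℚ)))
  chain : ι (a * c) ⊗ x ⊑ gale d□ p (w □)
  chain = begin
    ι (a * c) ⊗ x            ≈⟨ ⊗-scale {a} {c} (<⇒≤ 0<a) (<⇒≤ 0<c) x ⟩
    ι a ⊗ (ι c ⊗ x)          ≤⟨ ⊗-mono (ι-⊑ (<⇒≤ 0<a) la) cx⊑ ⟩
    α ⊗ gale d′ p (w □)      ≤⟨ ≤ᴿ⇒⊑ (subst (λ f → f α (gale d′ p (w □)) ≤ᴿ gale d□ p (w □)) (sym ⊗-def) α≤) ⟩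
    gale d□ p (w □)          ∎

-- Divides by an upper bound of `x` instead of `x` itself, which may be 0.
normalised : ∀ {x u} (ux : upper x u) → ι (reciprocal (upper-pos x ux)) ⊗ x ⊑ 1ᴿ
normalised {x} {u} ux = subst (λ z → ι i ⊗ x ⊑ ι z) (reciprocal-inverse (upper-pos x ux))
  (⊑-ι (upper-scale (reciprocal-pos (upper-pos x ux)) x ux))
  where
  i : ℚ
  i = reciprocal (upper-pos x ux)

module _ (d□ : Termgale) (optimal : IsOptimal d□) (S : Cantor) {s : ℝ⁺} {d : String → ℝ⁺}
         (d-supergale : IsSupergale s d) (d-semicomputable : LowerSemicomputable codeString d) (d-succeeds : Succeeds d S)
         {ρ θ κ p : ℚ} (0<ρ : 0ℚ < ρ) (0<θ : 0ℚ < θ) (θ<1 : θ < 1ℚ) (0<κ : 0ℚ < κ)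
         (ρ⊑ : ι ρ ⊑ 2⁻ s) (κd⊑1 : ι κ ⊗ d [] ⊑ 1ᴿ) (⊑θρ : 2⁻ ι p ⊑ ι (θ * ρ)) where
  open MassOf d {s} d-supergale 0<ρ 0<θ θ<1 0<κ ρ⊑ κd⊑1

  optimal-exceeds : ∀ n → ∃[ m ] n ℕ.≤ m × fromℕ 1 <ᴿ gale d□ (ι p) ((S ↾ m) □)
  optimal-exceeds n = go (IsOptimal.dominates optimal termgale (termgale-constructive (mass-semicomputable d-semicomputable)))
    where
    0<c : 0ℚ < κ□ * reciprocal 0<τ
    0<c = *-pos 0<κ□ (reciprocal-pos 0<τ)
    go : (∃[ α ] fromℕ 0 <ᴿ α × (∀ s w → α *ᴿ gale termgale s (w □) ≤ᴿ gale d□ s (w □))) →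
         ∃[ m ] n ℕ.≤ m × fromℕ 1 <ᴿ gale d□ (ι p) ((S ↾ m) □)
    go (α , (a , 0<a , la) , α≤) = m , proj₁ (proj₂ large) ,
      exceeds {d□} {termgale} {α} {ι p} {κ□ * reciprocal 0<τ} {a} {d (S ↾ m)} {S ↾ m} (α≤ (ι p) (S ↾ m)) 0<a la 0<c
        (termgale-lower-bound {ι p} ⊑θρ (S ↾ m)) (proj₂ (proj₂ large))
      where
      large : ∃[ m ] n ℕ.≤ m × lower (d (S ↾ m)) (2ℚ * reciprocal (*-pos 0<a 0<c))
      large = d-succeeds (2ℚ * reciprocal (*-pos 0<a 0<c)) n
      m : ℕ
      m = proj₁ large

liminf≤dimSequence : ∀ d□ → IsOptimal d□ → ∀ S q →
  above (dimSequence S) q → above (liminf (λ n → dimString d□ (S ↾ n))) q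
liminf≤dimSequence d□ optimal S q (s , (d , d-supergale , d-semicomputable , d-succeeds) , s<q) =
  let r , r<q , s<r = upper-open s s<q
      -- The chain is s < r < p < q′ < q: the gap from r to p provides ρ and θ, p is the exponent of
      -- the termgale, and q′ is the bound strictly below q that the supremum in `liminf` asks for.
      q′ , r<q′ , q′<q = <-dense r<q
      p , r<p , p<q′ = <-dense r<q′
      0<r = upper-pos s s<r
      ρ , θ , 0<ρ , 0<θ , θ<1 , ρ⊑ , ⊑θρ = 2⁻-gap 0<r r<p
      u , du = upper-inhabited (d [])
      0<κ = reciprocal-pos (upper-pos (d []) du)
  in q′ , q′<q , λ n →
     let m , n≤m , 1<g = optimal-exceeds d□ optimal S {s} {d} d-supergale d-semicomputable d-succeeds
           {p = p} 0<ρ 0<θ θ<1 0<κ (⊑-trans ρ⊑ (2⁻-mono (⊑-ι s<r))) (normalised {d []} du) ⊑θρ n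
     in m ℕ.∸ n , ι p ,
        lift (subst (λ k → fromℕ 1 <ᴿ gale d□ (ι p) ((S ↾ k) □)) (sym (ℕₚ.m+[n∸m]≡n n≤m)) 1<g) ,
        ι-upper (<⇒≤ (<-trans 0<r r<p)) p<q′

theorem5p9 : (d□ : Termgale) → IsOptimal d□ → (S : Cantor) →
    dimSequence S ≈∞ liminf (λ n → dimString d□ (S ↾ n))
theorem5p9 d□ optimal S q = mk⇔ (liminf≤dimSequence d□ optimal S q)
  (dimSequence≤liminf d□ (IsOptimal.constructive optimal) S q)
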